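{- Let $\mathbf{J}'=\mathbf{T}_1 \Join \mathbf{T}_2 \Join \dots \Join \mathbf{T}_m$ be an acyclic join query with $d$ columns and multiplication order $\rho$, let $\mathbf{J}\in\mathbb{R}^{N\times d}$ be its zero-padded form, and let an $(m,\rho)$-DB-Sketch algorithm with associated function $F$ be given. Then there exists an algorithm to evaluate $F(\mathbf{J})$ in time $$O\big(m\,(T_{\odot} + T_{\oplus})\, T_{\mathrm{FAQ}} + T_f\, m n d\big),$$ where $n$ is the number of rows of the largest table, $T_{\mathrm{FAQ}}$ is the time complexity of running a single-semiring FAQ on the join, and $T_{\odot}$ and $T_{\oplus}$ are the time complexities of the operators $\odot$ and $\oplus$, respectively.
   Context: Joins: a table $\mathbf{T}_i$ is a matrix with named columns. The (natural) join $\mathbf{J}'$ has the union of the columns of the tables as columns ($d$ in total); its rows are the tuples $X$ whose projection onto the columns of each $\mathbf{T}_i$ is a row of $\mathbf{T}_i$. A join is acyclic if one can reduce it to the empty query by repeatedly (1) removing a column contained in only one table, or (2) removing a table whose columns are all contained in another table. FAQ: given functions $g_i$ from the rows of $\mathbf{T}_i$ to a commutative semiring $(S,\oplus,\otimes)$, a single-semiring (SumProd) FAQ asks for $\bigoplus_{X\in\mathbf{J}'}\bigotimes_i g_i(X^{(i)})$, with $X^{(i)}$ the projection of $X$ onto the columns of $\mathbf{T}_i$. The Inside-Out algorithm of Abo Khamis, Ngo and Rudra (variable elimination / dynamic programming) computes such queries; $T_{\mathrm{FAQ}}$ denotes its running time with unit-cost semiring operations, and $T_{\mathrm{FAQ}}=O(md^2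 n^{\mathrm{fhtw}}\log n)$, where $\mathrm{fhtw}$ is the fractional hypertree width ($\mathrm{fhtw}=1$ for acyclic joins). Multiplication order $\rho$: a binary expression tree describing in what order Inside-Out multiplies the factors for an arbitrary single-semiring FAQ on the join: it has one leaf for each table (factor) and $m-1$ internal nodes, and two nodes with the same parent have their values multiplied together. The tables are numbered in the order in which a depth-first search of $\rho$ visits them. Zero-padded form: assign each column to exactly one of the tables containing it; $E_i$ is the set of columns assigned to $\mathbf{T}_i$, $X_i$ is the projection of a tuple $X$ onto $E_i$, and $D_i$ is the domain of $X_i$ (the projection of $\mathbf{T}_i$ onto $E_i$). Put $N=|D_1||D_2|\cdots|D_m|$. The matrix $\mathbf{J}\in\mathbb{R}^{N\times d}$ has one row for each tuple $X\in D_1\times\cdots\times D_m$ (ordered compatibly with Kronecker products): the row is $X$ itself if $X\in\mathbf{J}'$, and $0$ otherwise. $(m,\rho)$-DB-Sketch: an oblivious sketching algorithm for which there is a function $F$ from real matrices with $N$ rows and $d$ columns to a set $R_F$ ($F(\mathbf{A})$ represents the sketch of $\mathbf{A}$ in some form), and binary operators $\oplus,\odot$ on $R_F$, such that: 1. $F(\mathbf{A}_1+\mathbf{A}_2)=F(\mathbf{A}_1)\oplus F(\mathbf{A}_2)$, where $\oplus$ is commutative and associative. 2. For any Kronecker product $\mathbf{A}=\mathbf{A}_1\otimes\mathbf{A}_2\otimes\cdots\otimes\mathbf{A}_m$ (with $\mathbf{A}_i$ having $|D_i|$ rows), $F(\mathbf{A})=F_1(\mathbf{A}_1)\odot F_2(\mathbf{A}_2)\odot\cdots\odot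 F_m(\mathbf{A}_m)$, where $\odot$ is applied in the order given by $\rho$, and for each $i$ the function $F_i$ has the same range as $F$ and satisfies $F_i(X_1+X_2)=F_i(X_1)\oplus F_i(X_2)$. Furthermore $F_i(v_i)$ can be evaluated in time $O(T_f\,\mathrm{nnz}(v_i))$, where $\mathrm{nnz}$ is the number of non-zero entries. 3. For any $A,B,C$ in the range of $F$, $A\odot(B\oplus C)=(A\odot B)\oplus(A\odot C)$.
   Formalization: Item 3 of the DB-Sketch definition is strengthened: ⊙ distributes over ⊕ on both sides, not only A⊙(B⊕C)=(A⊙B)⊕(A⊙C); for non-commutative ⊙ the one-sided law does not suffice for the claimed bound, since sums in left factors need not be preserved. -}

module Defs where

open import Axiom.UniquenessOfIdentityProofs using (module Decidable⇒UIP)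
open import Level using (0ℓ; _⊔_) renaming (suc to lsuc)
open import Algebra.Bundles using (CommutativeRing; CommutativeSemiring)
import Algebra.Definitions as AlgDefs
open import Algebra.Structures using (IsCommutativeSemigroup)
open import Data.Bool.Base using (Bool; true; false; if_then_else_; _∧_)
open import Data.Fin.Base
  using (Fin; zero; suc; _↑ˡ_; _↑ʳ_; splitAt; quotient; remainder; cast; fromℕ<)
open import Data.Fin.Properties as Finₚ using (all?; any?)
open import Data.Fin.Subset using (Subset; ⁅_⁆; ⋃; _∈_; _∉_; _⊆_; _-_; Empty)
open import Data.List.Base as List
  using (List; []; _∷_; _++_; allFin; cartesianProduct; deduplicate; filter; length)
open import Data.List.Relation.Unary.All using (All)
open import Data.List.Relation.Unary.Any using (Any)
open import Data.Maybe.Base as Maybe using (Maybe; just; nothing; is-just; fromMaybe)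
open import Data.Nat.Base as ℕ using (ℕ; zero; suc; _≡ᵇ_; _<ᵇ_)
import Data.Nat.Properties as ℕₚ
open import Data.Product.Base using (∃; _×_; _,_; proj₁; curry; uncurry)
open import Data.Sum.Base using ([_,_])
open import Data.Unit.Base using (⊤)
open import Data.Vec.Functional as Vector using (Vector; tail)
open import Function.Base using (_∘_)
open import Function.Definitions using (Injective)
open import Relation.Binary.Bundles using (Setoid)
open import Relation.Binary.Construct.Closure.ReflexiveTransitive using (Star)
open import Relation.Binary.PropositionalEquality.Core using (_≡_; refl; subst)
open import Relation.Binary.Structures using (IsStrictTotalOrder)
open import Relation.Nullary using (Dec; yes; no; does; contradiction)
open import Relation.Nullary.Decidable using (map′; dec⇒maybe; ¬?; _×-dec_)

-- There are no real numbers in the library.  Nothing but the ring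
-- operations and exact comparisons of entries is ever used, so ℝ is replaced
-- by an arbitrary commutative ring with a decidable strict total order on
-- its elements; (classical) ℝ is an instance.

record Scalars c ℓ₁ ℓ₂ : Set (lsuc (c ⊔ ℓ₁ ⊔ ℓ₂)) where
  field
    commutativeRing : CommutativeRing c ℓ₁
  open CommutativeRing commutativeRing public
  field
    _<_                : Carrier → Carrier → Set ℓ₂
    isStrictTotalOrder : IsStrictTotalOrder _≈_ _<_
  open IsStrictTotalOrder isStrictTotalOrder public using (_≟_; _<?_)

∏ : ∀ {m} → Vector ℕ m → ℕ
∏ = Vector.foldr ℕ._*_ 1

-- Mixed-radix digits, the digit at position zero being the most significant
-- one: this is the ordering of rows and columns of a Kronecker product.
digits : ∀ {m} (ks : Vector ℕ m) → Fin (∏ ks) → ∀ i → Fin (ks i)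
digits {suc m} ks x zero    = quotient (∏ (tail ks)) x
digits {suc m} ks x (suc i) = digits (tail ks) (remainder {ks zero} (∏ (tail ks)) x) i

module Matrices {c ℓ₁ ℓ₂} (𝕊 : Scalars c ℓ₁ ℓ₂) where
  open Scalars 𝕊

  Matrix : ℕ → ℕ → Set c
  Matrix r k = Vector (Vector Carrier k) r

  _≈ᴹ_ : ∀ {r k} → Matrix r k → Matrix r k → Set ℓ₁
  A ≈ᴹ B = ∀ x y → A x y ≈ B x y

  _+ᴹ_ : ∀ {r k} → Matrix r k → Matrix r k → Matrix r k
  (A +ᴹ B) x y = A x y + B x y

  ⨂ : ∀ {m} {rs ks : Vector ℕ m} → (∀ i → Matrix (rs i) (ks i)) → Matrix (∏ rs) (∏ ks)
  ⨂ {rs = rs} {ks} A x y =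
    Vector.foldr _*_ 1# (λ i → A i (digits rs x i) (digits ks y i))

  nnz : ∀ {r k} → Matrix r k → ℕ
  nnz {r} {k} A =
    length (filter (λ (x , y) → ¬? (A x y ≟ 0#)) (cartesianProduct (allFin r) (allFin k)))

-- Binary trees with m leaves.  Reading the leaves from left to right, i.e. in
-- depth-first order, numbers them by Fin m.

data MulTree : ℕ → Set where
  leaf : MulTree 1
  _·_  : ∀ {a b} → MulTree a → MulTree b → MulTree (a ℕ.+ b)

evalTree : ∀ {a} {A : Set a} {m} → MulTree m → (A → A → A) → Vector A m → A
evalTree leaf              _∙_ xs = xs zero
evalTree (_·_ {a} {b} s t) _∙_ xs =
  evalTree s _∙_ (λ i → xs (i ↑ˡ b)) ∙ evalTree t _∙_ (λ i → xs (a ↑ʳ i))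

data Node : ∀ {m} → MulTree m → Set where
  root : ∀ {m} {t : MulTree m} → Node t
  inˡ  : ∀ {a b} {s : MulTree a} {t : MulTree b} → Node s → Node (s · t)
  inʳ  : ∀ {a b} {s : MulTree a} {t : MulTree b} → Node t → Node (s · t)

leafNode : ∀ {m} (t : MulTree m) → Fin m → Node t
leafNode leaf              _ = root
leafNode (_·_ {a} {b} s t) i = [ inˡ ∘ leafNode s , inʳ ∘ leafNode t ] (splitAt a i)

-- IsParent v l r: the node v is internal, with children l and r.
data IsParent : ∀ {m} {t : MulTree m} → Node t → Node t → Node t → Set where
  here   : ∀ {a b} {s : MulTree a} {t : MulTree b} →
           IsParent {t = s · t} root (inˡ root) (inʳ root)
  thereˡ : ∀ {a b} {s : MulTree a} {t : MulTree b} {v l r : Node s} →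
           IsParent v l r → IsParent {t = s · t} (inˡ v) (inˡ l) (inˡ r)
  thereʳ : ∀ {a b} {s : MulTree a} {t : MulTree b} {v l r : Node t} →
           IsParent v l r → IsParent {t = s · t} (inʳ v) (inʳ l) (inʳ r)

-- Table i has arity i columns; name i k is the name of its k-th column, as
-- an element of the set Fin d of all columns.  The map assign chooses, for
-- each column, one of the tables containing it.

record Query : Set where
  field
    m d            : ℕ
    arity          : Fin m → ℕ
    name           : ∀ i → Fin (arity i) → Fin d
    name-injective : ∀ i → Injective _≡_ _≡_ (name i)
    assign         : Fin d → Fin m
    assigned       : ∀ c → ∃ λ k → name (assign c) k ≡ c

  columns : Fin m → Subset d
  columns i = ⋃ (List.tabulate (λ k → ⁅ name i k ⁆))

data _⟶_ {d} : List (Subset d) → List (Subset d) → Set where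
  dropColumn : ∀ {es es′ e c} → c ∈ e → All (c ∉_) es → All (c ∉_) es′ →
               (es ++ e ∷ es′) ⟶ (es ++ (e - c) ∷ es′)
  dropTable  : ∀ {es es′ e} → Any (e ⊆_) (es ++ es′) →
               (es ++ e ∷ es′) ⟶ (es ++ es′)

-- The last table can never be dropped, so "empty" means: no columns left.
Acyclic : Query → Set
Acyclic Q = ∃ λ es → Star _⟶_ (List.tabulate columns) es × All Empty es
  where open Query Q

record Tables {c ℓ₁ ℓ₂} (𝕊 : Scalars c ℓ₁ ℓ₂) (Q : Query) : Set c where
  open Query Q
  open Matrices 𝕊
  field
    size  : Fin m → ℕ
    table : ∀ i → Matrix (size i) (arity i)

  maxSize : ℕ
  maxSize = Vector.foldr ℕ._⊔_ 0 size

module Join {c ℓ₁ ℓ₂} {𝕊 : Scalars c ℓ₁ ℓ₂} {Q : Query} (I : Tables 𝕊 Q) where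
  open Scalars 𝕊 using (Carrier; _≈_; _≟_; 0#)
  open Matrices 𝕊
  open Query Q
  open Tables I

  InJoin : Vector Carrier d → Set ℓ₁
  InJoin X = ∀ i → ∃ λ r → ∀ k → table i r k ≈ X (name i k)

  inJoin? : ∀ X → Dec (InJoin X)
  inJoin? X = all? λ i → any? λ r → all? λ k → table i r k ≟ X (name i k)

  E : Fin m → Set
  E i = ∃ λ c → assign c ≡ i

  proj : ∀ i → Fin (size i) → E i → Carrier
  proj i r (c , refl) = table i r (proj₁ (assigned c))

  Agree : ∀ {i} → (E i → Carrier) → (E i → Carrier) → Set ℓ₁
  Agree u v = ∀ e → u e ≈ v e

  agree? : ∀ {i} (u v : E i → Carrier) → Dec (Agree u v)
  agree? {i} u v = map′ uncurry curry (all? atColumn)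
    where
    atColumn : ∀ c → Dec (∀ p → u (c , p) ≈ v (c , p))
    atColumn c with assign c Finₚ.≟ i
    ... | no ¬p = yes λ p → contradiction p ¬p
    ... | yes p = map′ (λ eq q → subst (λ q → u (c , q) ≈ v (c , q))
                                       (Decidable⇒UIP.≡-irrelevant Finₚ._≟_ p q) eq)
                       (λ f → f p)
                       (u (c , p) ≟ v (c , p))

  -- D i, without repetitions.
  D : ∀ i → List (E i → Carrier)
  D i = deduplicate agree? (List.tabulate (proj i))

  ∣D∣ : Vector ℕ m
  ∣D∣ i = length (D i)

  N : ℕ
  N = ∏ ∣D∣

  -- The x-th element of D₁ × ⋯ × Dₘ.
  tuple : Fin N → Vector Carrier d
  tuple x c = List.lookup (D (assign c)) (digits ∣D∣ x (assign c)) (c , refl)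

  -- Every tuple in the join lies in D₁ × ⋯ × Dₘ, in exactly one place.
  join : List (Vector Carrier d)
  join = filter inJoin? (List.tabulate tuple)

  J : Matrix N d
  J x c = if does (inJoin? (tuple x)) then tuple x c else 0#

  module _ {s ℓ} (S : CommutativeSemiring s ℓ) where
    private module S = CommutativeSemiring S

    Weights : Set (c ⊔ s)
    Weights = ∀ i → Vector Carrier (arity i) → S.Carrier

    Congruent : Weights → Set (c ⊔ ℓ₁ ⊔ ℓ)
    Congruent g = ∀ i {u v} → (∀ k → u k ≈ v k) → g i u S.≈ g i v

    faq : Weights → S.Carrier
    faq g = List.foldr S._+_ S.0#
      (List.map (λ X → Vector.foldr S._*_ S.1# (λ i → g i (X ∘ name i))) join)

-- Matrices are functions, so compatibility with pointwise equality has to be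
-- required of F and of the Fᵢ.  The matrices fed to Fᵢ have a prescribed number
-- of rows and any number of columns.  Distributivity is two-sided, as in
-- the (commutative) semirings of FAQs: products in the order ρ can have sums
-- in their left factors as well as in their right ones.

record DBSketch {c ℓ₁ ℓ₂} (𝕊 : Scalars c ℓ₁ ℓ₂) (d : ℕ)
                {m} (rows : Vector ℕ m) (ρ : MulTree m) r ℓ
                : Set (c ⊔ ℓ₁ ⊔ lsuc (r ⊔ ℓ)) where
  open Matrices 𝕊
  infixl 6 _⊕_
  infixl 7 _⊙_
  field
    R_F     : Setoid r ℓ
  open Setoid R_F public using (Carrier; _≈_)
  open AlgDefs _≈_ using (Congruent₂; _DistributesOver_)
  field
    F       : Matrix (∏ rows) d → Carrier
    F-cong  : ∀ {A B} → A ≈ᴹ B → F A ≈ F B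
    Fᵢ      : ∀ i {k} → Matrix (rows i) k → Carrier
    Fᵢ-cong : ∀ i {k} {A B : Matrix (rows i) k} → A ≈ᴹ B → Fᵢ i A ≈ Fᵢ i B
    _⊕_ _⊙_ : Carrier → Carrier → Carrier
    ⊙-cong  : Congruent₂ _⊙_
    ⊕-isCommutativeSemigroup : IsCommutativeSemigroup _≈_ _⊕_
    F-+     : ∀ A B → F (A +ᴹ B) ≈ F A ⊕ F B
    Fᵢ-+    : ∀ i {k} (A B : Matrix (rows i) k) → Fᵢ i (A +ᴹ B) ≈ Fᵢ i A ⊕ Fᵢ i B
    F-⨂     : ∀ {ks : Vector ℕ m} (d≡∏ks : d ≡ ∏ ks) (A : ∀ i → Matrix (rows i) (ks i)) →
              F (λ x y → ⨂ A x (cast d≡∏ks y)) ≈ evalTree ρ _⊙_ (λ i → Fᵢ i (A i))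
    distrib : _⊙_ DistributesOver _⊕_

-- Programs work on two memories, one for natural numbers and one for opaque
-- values (of a semiring, or sketches).  Each consists of infinitely many
-- infinite arrays; arrays are named statically, cells are addressed
-- dynamically.  Tables are accessed by comparing entries.  Programs may
-- depend on the query, but not on the contents or sizes of the tables.

module _ (Q : Query) where
  open Query Q

  infixl 8 _[_]
  infixl 6 _:+_ _:∸_

  data Exp : Set where
    lit       : ℕ → Exp
    rowsOf    : Fin m → Exp
    _[_]      : ℕ → Exp → Exp
    _:+_ _:∸_ : Exp → Exp → Exp

  data Test : Set where
    less   : Exp → Exp → Test
    cell<  : ∀ i → Exp → Fin (arity i) → ∀ j → Exp → Fin (arity j) → Test
    filled : ℕ → Exp → Test

  infixr 4 _⨾_

  -- In Cmd L, the elements of L are instructions producing a value.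
  data Cmd (L : Set) : Set where
    skip     : Cmd L
    word     : ℕ → Exp → Exp → Cmd L
    produce  : ℕ → Exp → L → Cmd L
    copy     : ℕ → Exp → ℕ → Exp → Cmd L
    add mul  : ℕ → Exp → ℕ → Exp → ℕ → Exp → Cmd L
    _⨾_      : Cmd L → Cmd L → Cmd L
    branch   : Test → Cmd L → Cmd L → Cmd L
    while    : Test → Cmd L → Cmd L

  -- The value of the i-th factor at the row of table i with the given index.
  data Factor : Set where
    factor : Fin m → Exp → Factor

  data Entry (i : Fin m) : Set where
    one  : Entry i
    cell : Exp → Fin (arity i) → Entry i

  -- sketch i k es: the sketch Fᵢ(A) of the matrix A with k columns that is the
  -- sum of the listed entries.  A row of A is an element of Dᵢ, and is
  -- designated by the index of a row of table i that projects to it.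
  data Sketching : Set where
    sketch : ∀ i (k : ℕ) → List (Exp × Fin k × Entry i) → Sketching

  -- Typing of the arrays by nodes of ρ: a value of type v is (a sum of)
  -- products of the factors below v, and products are formed as in ρ.
  Follows : ∀ (ρ : MulTree m) → (ℕ → Node ρ) → Cmd Factor → Set
  Follows ρ τ skip                         = ⊤
  Follows ρ τ (word _ _ _)                 = ⊤
  Follows ρ τ (produce x _ (factor i _))   = τ x ≡ leafNode ρ i
  Follows ρ τ (copy x _ y _)               = τ x ≡ τ y
  Follows ρ τ (add x _ y _ z _)            = τ x ≡ τ y × τ x ≡ τ z
  Follows ρ τ (mul x _ y _ z _)            = IsParent (τ x) (τ y) (τ z)
  Follows ρ τ (p ⨾ q)                      = Follows ρ τ p × Follows ρ τ q
  Follows ρ τ (branch _ p q)               = Follows ρ τ p × Follows ρ τ q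
  Follows ρ τ (while _ p)                  = Follows ρ τ p

Memory : ∀ {a} → Set a → Set a
Memory A = ℕ → ℕ → A

_[_,_]≔_ : ∀ {a} {A : Set a} → Memory A → ℕ → ℕ → A → Memory A
(M [ x , k ]≔ v) y l = if (x ≡ᵇ y) ∧ (k ≡ᵇ l) then v else M y l

row? : ∀ n → ℕ → Maybe (Fin n)
row? n k = Maybe.map (λ k<n → fromℕ< k<n) (dec⇒maybe (k ℕₚ.<? n))

-- The interpretation and the running times of the operations on values.
record Values (L : Set) v : Set (lsuc v) where
  field
    Value             : Set v
    _⊞_ _⊠_           : Value → Value → Value
    value             : Memory ℕ → L → Maybe Value
    cost-⊞ cost-⊠     : ℕ
    cost-value        : Memory ℕ → L → ℕ

module Semantics {c ℓ₁ ℓ₂} {𝕊 : Scalars c ℓ₁ ℓ₂} {Q : Query} (I : Tables 𝕊 Q) where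
  open Scalars 𝕊 using (_<?_; 0#; 1#; Carrier)
  open Matrices 𝕊
  open Query Q
  open Tables I
  open Join I

  ⟦_⟧ : Exp Q → Memory ℕ → ℕ
  ⟦ lit n ⟧    w = n
  ⟦ rowsOf i ⟧ w = size i
  ⟦ x [ e ] ⟧  w = w x (⟦ e ⟧ w)
  ⟦ e :+ f ⟧   w = ⟦ e ⟧ w ℕ.+ ⟦ f ⟧ w
  ⟦ e :∸ f ⟧   w = ⟦ e ⟧ w ℕ.∸ ⟦ f ⟧ w

  ∣_∣ : Exp Q → ℕ
  ∣ lit n ∣    = 1
  ∣ rowsOf i ∣ = 1
  ∣ x [ e ] ∣  = 1 ℕ.+ ∣ e ∣
  ∣ e :+ f ∣   = 1 ℕ.+ ∣ e ∣ ℕ.+ ∣ f ∣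
  ∣ e :∸ f ∣   = 1 ℕ.+ ∣ e ∣ ℕ.+ ∣ f ∣

  entry? : Memory ℕ → ∀ i → Exp Q → Fin (arity i) → Maybe Carrier
  entry? w i e k = Maybe.map (λ r → table i r k) (row? (size i) (⟦ e ⟧ w))

  -- nothing: access to a row that does not exist
  test : ∀ {v} {V : Set v} → Memory ℕ → Memory (Maybe V) → Test Q → Maybe Bool
  test w s (less e f)           = just (⟦ e ⟧ w <ᵇ ⟦ f ⟧ w)
  test w s (cell< i e k j f l)  =
    Maybe.zipWith (λ a b → does (a <? b)) (entry? w i e k) (entry? w j f l)
  test w s (filled x e)         = just (is-just (s x (⟦ e ⟧ w)))

  cost-test : Test Q → ℕ
  cost-test (less e f)          = 1 ℕ.+ ∣ e ∣ ℕ.+ ∣ f ∣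
  cost-test (cell< _ e _ _ f _) = 1 ℕ.+ ∣ e ∣ ℕ.+ ∣ f ∣
  cost-test (filled _ e)        = 1 ℕ.+ ∣ e ∣

  module _ {L : Set} {v} (V : Values L v) where
    open Values V

    State : Set v
    State = Memory ℕ × Memory (Maybe Value)

    initial : State
    initial = (λ _ _ → 0) , (λ _ _ → nothing)

    -- Run p σ t σ′: started in state σ, p stops in state σ′ after time t.
    data Run : Cmd Q L → State → ℕ → State → Set v where
      skip    : ∀ {σ} → Run skip σ 1 σ
      word    : ∀ {w s x e f} →
                Run (word x e f) (w , s) (1 ℕ.+ ∣ e ∣ ℕ.+ ∣ f ∣) ((w [ x , ⟦ e ⟧ w ]≔ ⟦ f ⟧ w) , s)
      produce : ∀ {w s x e l a} → value w l ≡ just a →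
                Run (produce x e l) (w , s) (cost-value w l ℕ.+ ∣ e ∣)
                    (w , (s [ x , ⟦ e ⟧ w ]≔ just a))
      copy    : ∀ {w s x e y f a} → s y (⟦ f ⟧ w) ≡ just a →
                Run (copy x e y f) (w , s) (1 ℕ.+ ∣ e ∣ ℕ.+ ∣ f ∣) (w , (s [ x , ⟦ e ⟧ w ]≔ just a))
      add     : ∀ {w s x e y f z g a b} → s y (⟦ f ⟧ w) ≡ just a → s z (⟦ g ⟧ w) ≡ just b →
                Run (add x e y f z g) (w , s) (cost-⊞ ℕ.+ ∣ e ∣ ℕ.+ ∣ f ∣ ℕ.+ ∣ g ∣)
                    (w , (s [ x , ⟦ e ⟧ w ]≔ just (a ⊞ b)))
      mul     : ∀ {w s x e y f z g a b} → s y (⟦ f ⟧ w) ≡ just a → s z (⟦ g ⟧ w) ≡ just b →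
                Run (mul x e y f z g) (w , s) (cost-⊠ ℕ.+ ∣ e ∣ ℕ.+ ∣ f ∣ ℕ.+ ∣ g ∣)
                    (w , (s [ x , ⟦ e ⟧ w ]≔ just (a ⊠ b)))
      seq     : ∀ {p q σ₁ σ₂ σ₃ t₁ t₂} → Run p σ₁ t₁ σ₂ → Run q σ₂ t₂ σ₃ →
                Run (p ⨾ q) σ₁ (t₁ ℕ.+ t₂) σ₃
      branch  : ∀ {b c p q w s t σ} → test w s c ≡ just b →
                Run (if_then_else_ b p q) (w , s) t σ → Run (branch c p q) (w , s) (cost-test c ℕ.+ t) σ
      stop    : ∀ {c p w s} → test w s c ≡ just false →
                Run (while c p) (w , s) (cost-test c) (w , s)
      loop    : ∀ {c p w s t₁ t₂ σ₁ σ₂} → test w s c ≡ just true →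
                Run p (w , s) t₁ σ₁ → Run (while c p) σ₁ t₂ σ₂ →
                Run (while c p) (w , s) (cost-test c ℕ.+ t₁ ℕ.+ t₂) σ₂

    output : State → Maybe Value
    output (_ , s) = s 0 0

  faqValues : ∀ {s ℓ} (S : CommutativeSemiring s ℓ) → Weights S → Values (Factor Q) s
  faqValues S g = record
    { Value      = S.Carrier
    ; _⊞_        = S._+_
    ; _⊠_        = S._*_
    ; value      = λ { w (factor i e) →
                       Maybe.map (λ r → g i (table i r)) (row? (size i) (⟦ e ⟧ w)) }
    ; cost-⊞     = 1
    ; cost-⊠     = 1
    ; cost-value = λ { w (factor i e) → 1 ℕ.+ ∣ e ∣ }
    }
    where module S = CommutativeSemiring S

  entryValue : Memory ℕ → ∀ i → Entry Q i → Maybe Carrier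
  entryValue w i one        = just 1#
  entryValue w i (cell e k) = entry? w i e k

  ∣_∣ₑ : ∀ {i} → Entry Q i → ℕ
  ∣ one ∣ₑ      = 1
  ∣ cell e _ ∣ₑ = 1 ℕ.+ ∣ e ∣

  unitMatrix : ∀ i {k} → Fin (size i) → Fin k → Carrier → Matrix (∣D∣ i) k
  unitMatrix i r y a x y′ =
    if does (agree? (List.lookup (D i) x) (proj i r) ×-dec (y Finₚ.≟ y′)) then a else 0#

  matrix : Memory ℕ → ∀ i {k} → List (Exp Q × Fin k × Entry Q i) → Maybe (Matrix (∣D∣ i) k)
  matrix w i []                 = just (λ _ _ → 0#)
  matrix w i ((e , y , a) ∷ es) =
    Maybe.zipWith _+ᴹ_
      (Maybe.zipWith (λ r → unitMatrix i r y) (row? (size i) (⟦ e ⟧ w)) (entryValue w i a))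
      (matrix w i es)

  -- T⊕, T⊙ and T_f are the running times of the operations of the sketch,
  -- evaluating Fᵢ(A) taking time T_f · nnz(A).
  module _ {d′ ρ r ℓ} (Sk : DBSketch 𝕊 d′ ∣D∣ ρ r ℓ) (T⊕ T⊙ T_f : ℕ) where
    private module Sk = DBSketch Sk

    sketchValues : Values (Sketching Q) r
    sketchValues = record
      { Value      = Sk.Carrier
      ; _⊞_        = Sk._⊕_
      ; _⊠_        = Sk._⊙_
      ; value      = λ { w (sketch i k es) → Maybe.map (Sk.Fᵢ i) (matrix w i es) }
      ; cost-⊞     = T⊕
      ; cost-⊠     = T⊙
      ; cost-value = λ { w (sketch i k es) →
          1 ℕ.+ T_f ℕ.* Maybe.maybe nnz 0 (matrix w i es)
            ℕ.+ List.sum (List.map (λ (e , _ , a) → ∣ e ∣ ℕ.+ ∣ a ∣ₑ) es) }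
      }

-- An algorithm that evaluates single-semiring FAQs on the given join, for
-- arbitrary tables, semirings and weights, multiplying in the order ρ.
-- Its running time is the number of machine steps, where semiring operations
-- count as single steps.  An output cell that has not been filled stands
-- for the empty sum.

record FAQAlgorithm {c ℓ₁ ℓ₂} (𝕊 : Scalars c ℓ₁ ℓ₂) (Q : Query) (ρ : MulTree (Query.m Q))
                    : Set (lsuc 0ℓ ⊔ c ⊔ ℓ₁) where
  open Join using (Weights; Congruent; faq)
  open Semantics using (Run; faqValues; initial; output)
  field
    program   : Cmd Q (Factor Q)
    nodeOf    : ℕ → Node ρ
    follows   : Follows Q ρ nodeOf program
    out-root  : nodeOf 0 ≡ root
    T-FAQ     : Tables 𝕊 Q → ℕ
    evaluates : ∀ I (S : CommutativeSemiring 0ℓ 0ℓ) (g : Weights I S) → Congruent I S g →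
                let open CommutativeSemiring S; V = faqValues I S g in
                ∃ λ σ → Run I V program (initial I V) (T-FAQ I) σ ×
                        fromMaybe 0# (output I V σ) ≈ faq I S g

{-# OPTIONS --safe #-}
module Submission where

-- Let Jᵢ consist of the columns of J assigned to table i, so that J is the sum of
-- the Jᵢ.  A tuple X of the join contributes to Jᵢ the Kronecker product of
-- the matrices that have one nonzero row, the one of Xⱼ: for j ≢ i this row is
-- the single entry 1, and for j ≡ i it has the d columns of J, with the
-- entries of Xᵢ and zeros elsewhere (blockRow-value, J-blocks).  Hence F(Jᵢ)
-- is a sum over the join of products, in the order ρ, of sketches of such leaf matrices: it has
-- the shape of a FAQ, and the given algorithm is run once for each i, with these
-- leaf sketches as weights.
--
-- Sketches need not form a commutative semiring: there may be no neutral elements,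
-- and the product may be neither associative nor commutative.  So the correctness
-- of the FAQ algorithm cannot be applied to them directly.  But its control
-- flow does not depend on the values it computes with.  The same run can be
-- carried out on sketches and on the elements of any commutative semiring,
-- and then both memories hold the values of the same expressions (simulate).
-- As the program follows ρ, distributivity turns such an expression into
-- a sum of monomials, each being the choice of one row of every table, multiplied
-- in the order ρ (monomials-sum).  Which monomials occur is found out by the
-- semiring of functions from such choices to ℕ, the weight of a row being
-- the indicator function of the choices that contain it.  There an expression
-- counts its monomials, and the FAQ counts the tuples of the join.  So
-- the correctness of the algorithm says that the monomials are, up to equality
-- of rows, the tuples of the join with the same multiplicities; hence the value
-- among sketches is F(Jᵢ) (term-sketch).
--
-- The sum is started at F(0), the product of sketches of zero matrices, so that
-- there is an output even if the join is empty or d = 0.  If a run of the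
-- FAQ algorithm leaves its output empty, then the join has no tuples, and
-- nothing has to be added (empty-sketch).
--
-- The leaf sketches are computed once and stored in arrays: two for each row of
-- a table, of matrices with at most 1 and at most d nonzero entries, which takes
-- time O(T_f m n d); only for d = 0, when F(0) is the result, they have to be
-- left out.  In the m runs the production of a factor becomes copying
-- a cell, and every step gets slower by a factor of at most T⊙ + T⊕.

open import Defs
open import Algebra.Bundles using (CommutativeMonoid; CommutativeSemiring)
import Algebra.Construct.Pointwise as Pointwise
import Algebra.Definitions as AlgDefs
open import Algebra.Structures using (IsCommutativeSemigroup)
open import Data.Bool.Base using (Bool; true; false; if_then_else_)
open import Data.Bool.Properties as Bool using (if-eta)
open import Data.Fin.Base as Fin
  using (Fin; zero; suc; toℕ; fromℕ<; cast; combine; quotient; remainder; splitAt; _↑ˡ_; _↑ʳ_)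
open import Data.Fin.Properties as Finₚ using (all?)
open import Data.List.Base as List
  using (List; []; _∷_; _++_; allFin; cartesianProduct; filter; length)
open import Data.List.Membership.Propositional using (_∈_)
open import Data.List.Membership.Propositional.Properties
  using (∈-allFin; ∈-cartesianProduct⁺; ∈-cartesianProduct⁻; ∈-filter⁻; ∈-lookup; ∈-map⁻)
open import Data.List.Properties
  using (filter-++; filter-accept; filter-none; filter-reject; foldr-++; length-++; length-filter;
         length-map; length-tabulate; map-tabulate)
open import Data.List.Relation.Unary.All as All using (All; []; _∷_)
open import Data.List.Relation.Unary.AllPairs using (AllPairs; []; _∷_)
open import Data.List.Relation.Unary.Any using (here; there)
import Data.List.Relation.Unary.Unique.DecSetoid.Properties as Unique
open import Data.List.Relation.Unary.Unique.Propositional using (Unique)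
open import Data.List.Relation.Unary.Unique.Propositional.Properties using (allFin⁺)
open import Data.Maybe.Base as Maybe using (Maybe; just; nothing; fromMaybe; is-just)
open import Data.Nat.Base as ℕ
  using (ℕ; zero; suc; NonZero; >-nonZero⁻¹; _+_; _∸_; _*_; _%_; _≤_; _<_; z≤n; s≤s)
import Data.Nat.DivMod as ℕ
import Data.Nat.Properties as ℕ
open import Data.Nat.Solver using (module +-*-Solver)
open import Data.Product.Base using (∃; _×_; _,_; proj₁; proj₂)
open import Data.Product.Properties using (≡-dec)
open import Data.Sum.Base using (_⊎_; [_,_]; inj₁; inj₂)
open import Data.Unit.Base using (⊤; tt)
open import Data.Vec.Functional as Vector using (Vector; tail)
open import Function.Base using (_∘_; id)
open import Function.Bundles using (mk⇔)
open import Level using (Level; 0ℓ; _⊔_)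
open import Relation.Binary.Bundles using (DecSetoid; Setoid)
open import Relation.Binary.PropositionalEquality
  using (_≡_; _≢_; refl; sym; trans; cong; cong₂; subst; module ≡-Reasoning)
open import Relation.Nullary using (¬_; Dec; yes; no; does; contradiction)
open import Relation.Nullary.Decidable
  using (_×-dec_; ¬?; dec-false; dec-true; does-⇔)
open import Relation.Unary using (Pred; Decidable)

open +-*-Solver using (solve; con; _:=_) renaming (_:+_ to _⊹_; _:*_ to _⊛_)

private variable
  p q r x y ℓ : Level
  a b k : ℕ

-- Indicators and products along a tree

-- The indicator of a decidable proposition.
ind : {P : Set p} → Dec P → ℕ
ind P? = if does P? then 1 else 0

ind-cong : {P : Set p} {Q : Set q} → (P → Q) → (Q → P) →
           (P? : Dec P) (Q? : Dec Q) → ind P? ≡ ind Q?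
ind-cong f g P? Q? = cong (if_then 1 else 0) (does-⇔ (mk⇔ f g) P? Q?)

ind-× : {P : Set p} {Q : Set q} (P? : Dec P) (Q? : Dec Q) →
        ind P? * ind Q? ≡ ind (P? ×-dec Q?)
ind-× P? Q? with does P? | does Q?
... | false | _     = refl
... | true  | false = refl
... | true  | true  = refl

module _ {R : Set r} (_≈_ : R → R → Set ℓ) {_∙_ : R → R → R}
         (∙-cong : AlgDefs.Congruent₂ _≈_ _∙_) where

  evalTree-cong : (t : MulTree k) {xs ys : Vector R k} →
                  (∀ i → xs i ≈ ys i) → evalTree t _∙_ xs ≈ evalTree t _∙_ ys
  evalTree-cong leaf              eq = eq zero
  evalTree-cong (_·_ {a} {b} s t) eq =
    ∙-cong (evalTree-cong s (eq ∘ (_↑ˡ b))) (evalTree-cong t (eq ∘ (a ↑ʳ_)))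

-- A dependent function on Fin (a + b) from its two halves.
glue : {A : Fin (a + b) → Set p} → (∀ j → A (j ↑ˡ b)) → (∀ j → A (a ↑ʳ j)) → ∀ i → A i
glue {zero}  f g i       = g i
glue {suc a} f g zero    = f zero
glue {suc a} f g (suc i) = glue {a} (f ∘ suc) g i

glue-ˡ : {A : Fin (a + b) → Set p} (f : ∀ j → A (j ↑ˡ b)) (g : ∀ j → A (a ↑ʳ j)) →
         ∀ j → glue {A = A} f g (j ↑ˡ b) ≡ f j
glue-ˡ {suc a} f g zero    = refl
glue-ˡ {suc a} f g (suc j) = glue-ˡ {a} (f ∘ suc) g j

glue-ʳ : {A : Fin (a + b) → Set p} (f : ∀ j → A (j ↑ˡ b)) (g : ∀ j → A (a ↑ʳ j)) →
         ∀ j → glue {A = A} f g (a ↑ʳ j) ≡ g j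
glue-ʳ {zero}  f g j = refl
glue-ʳ {suc a} f g j = glue-ʳ {a} (f ∘ suc) g j

evalTree-ind : (t : MulTree k) {P : Fin k → Set p} (P? : ∀ i → Dec (P i)) →
               evalTree t _*_ (ind ∘ P?) ≡ ind (all? P?)
evalTree-ind leaf P? = ind-cong (λ { p zero → p ; p (suc ()) }) (λ f → f zero) (P? zero) (all? P?)
evalTree-ind (_·_ {a} {b} s t) {P} P?
  rewrite evalTree-ind s (P? ∘ (_↑ˡ b)) | evalTree-ind t (P? ∘ (a ↑ʳ_)) =
  trans (ind-× (all? (P? ∘ (_↑ˡ b))) (all? (P? ∘ (a ↑ʳ_))))
        (ind-cong (λ (f , g) → glue {A = P} f g) (λ f → f ∘ (_↑ˡ b) , f ∘ (a ↑ʳ_))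
                  (all? (P? ∘ (_↑ˡ b)) ×-dec all? (P? ∘ (a ↑ʳ_))) (all? P?))

foldr-ind : {P : Fin k → Set p} (P? : ∀ i → Dec (P i)) →
            Vector.foldr _*_ 1 (ind ∘ P?) ≡ ind (all? P?)
foldr-ind {zero}  P? = ind-cong {P = ⊤} (λ _ ()) (λ _ → tt) (yes tt) (all? P?)
foldr-ind {suc k} P? rewrite foldr-ind (P? ∘ suc) =
  trans (ind-× (P? zero) (all? (P? ∘ suc)))
        (ind-cong (λ { (p , f) zero → p ; (p , f) (suc i) → f i }) (λ f → f zero , f ∘ suc)
                  (P? zero ×-dec all? (P? ∘ suc)) (all? P?))

-- Monomials: choices of one element for each leaf

-- A choice of one element for each leaf of a tree, as nested pairs.
Choice : MulTree k → (Fin k → Set) → Set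
Choice leaf              A = A zero
Choice (_·_ {a} {b} s t) A = Choice s (A ∘ (_↑ˡ b)) × Choice t (A ∘ (a ↑ʳ_))

-- A choice of one element for each leaf below a node.
ChoiceAt : {t : MulTree k} → Node t → (Fin k → Set) → Set
ChoiceAt {t = t} root            A = Choice t A
ChoiceAt         (inˡ {b = b} v) A = ChoiceAt v (A ∘ (_↑ˡ b))
ChoiceAt         (inʳ {a = a} v) A = ChoiceAt v (A ∘ (a ↑ʳ_))

chooseSide : (s : MulTree a) (t : MulTree b) {A : Fin (a + b) → Set} → ∀ {i} w → splitAt a i ≡ w →
             A i → ChoiceAt {t = s · t} ([ inˡ ∘ leafNode s , inʳ ∘ leafNode t ] w) A

-- The generator u for the leaf i, as a choice for the leaves below the node of i.
choose : (t : MulTree k) {A : Fin k → Set} → ∀ i → A i → ChoiceAt (leafNode t i) A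
choose leaf            zero u = u
choose (_·_ {a} s t) i    u = chooseSide s t (splitAt a i) refl u

chooseSide     s t (inj₁ j) eq u with refl ← Finₚ.splitAt⁻¹-↑ˡ eq = choose s j u
chooseSide {a} s t (inj₂ j) eq u with refl ← Finₚ.splitAt⁻¹-↑ʳ {a} eq = choose t j u

-- The leaves below an internal node are those below its two children.
pair : {t : MulTree k} {A : Fin k → Set} {v l r : Node t} →
       IsParent v l r → ChoiceAt l A → ChoiceAt r A → ChoiceAt v A
pair here       c e = c , e
pair (thereˡ p) c e = pair p c e
pair (thereʳ p) c e = pair p c e

-- A choice as a dependent function on the leaves.
assignment : (t : MulTree k) {A : Fin k → Set} → Choice t A → ∀ i → A i
assignment leaf        c zero = c
assignment (s · t) {A} (c , e)  = glue {A = A} (assignment s c) (assignment t e)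

module _ {R : Set r} (_∙_ : R → R → R) where

  -- The product of the chosen elements, multiplied as in the tree.
  product : (t : MulTree k) {A : Fin k → Set} → (∀ i → A i → R) → Choice t A → R
  product leaf              h c       = h zero c
  product (_·_ {a} {b} s t) h (c , e) = product s (h ∘ (_↑ˡ b)) c ∙ product t (h ∘ (a ↑ʳ_)) e

  -- The same for the leaves below a node.
  productAt : {t : MulTree k} (v : Node t) {A : Fin k → Set} →
              (∀ i → A i → R) → ChoiceAt v A → R
  productAt {t = t} root            h c = product t h c
  productAt         (inˡ {b = b} v) h c = productAt v (h ∘ (_↑ˡ b)) c
  productAt         (inʳ {a = a} v) h c = productAt v (h ∘ (a ↑ʳ_)) c

  productAt-choose : (t : MulTree k) {A : Fin k → Set} (h : ∀ i → A i → R) → ∀ i u →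
                     productAt (leafNode t i) h (choose t i u) ≡ h i u
  productAt-choose leaf                  h zero u = refl
  productAt-choose (_·_ {a} {b} s t) {A} h i    u = side (splitAt a i) refl
    where
    side : ∀ w (eq : splitAt a i ≡ w) →
           productAt {t = s · t} ([ inˡ ∘ leafNode s , inʳ ∘ leafNode t ] w) {A} h (chooseSide s t w eq u) ≡ h i u
    side (inj₁ j) eq with refl ← Finₚ.splitAt⁻¹-↑ˡ eq = productAt-choose s (h ∘ (_↑ˡ b)) j u
    side (inj₂ j) eq with refl ← Finₚ.splitAt⁻¹-↑ʳ {a} eq = productAt-choose t (h ∘ (a ↑ʳ_)) j u

  productAt-pair : {t : MulTree k} {A : Fin k → Set} (h : ∀ i → A i → R) {v l r : Node t} →
                   (p : IsParent v l r) (c : ChoiceAt l A) (e : ChoiceAt r A) →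
                   productAt v h (pair p c e) ≡ productAt l h c ∙ productAt r h e
  productAt-pair h here                c e = refl
  productAt-pair h (thereˡ {b = b} p) c e = productAt-pair (h ∘ (_↑ˡ b)) p c e
  productAt-pair h (thereʳ {a = a} p) c e = productAt-pair (h ∘ (a ↑ʳ_)) p c e

  product≡evalTree : (t : MulTree k) {A : Fin k → Set} (h : ∀ i → A i → R) (c : Choice t A) →
                     product t h c ≡ evalTree t _∙_ (λ i → h i (assignment t c i))
  product≡evalTree leaf              h c       = refl
  product≡evalTree (_·_ {a} {b} s t) {A} h (c , e) = cong₂ _∙_
    (trans (product≡evalTree s (h ∘ (_↑ˡ b)) c)
           (evalTree-cong _≡_ (cong₂ _∙_) s λ j →
             cong (h (j ↑ˡ b)) (sym (glue-ˡ {A = A} (assignment s c) (assignment t e) j))))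
    (trans (product≡evalTree t (h ∘ (a ↑ʳ_)) e)
           (evalTree-cong _≡_ (cong₂ _∙_) t λ j →
             cong (h (a ↑ʳ j)) (sym (glue-ʳ {a} {A = A} (assignment s c) (assignment t e) j))))

-- Expressions and their expansion into monomials

-- The expressions that a program following the tree can compute.  Those of type
-- v are sums of products of generators, one for each leaf below v, multiplied as
-- in the tree.
data Term (t : MulTree k) (A : Fin k → Set) : Node t → Set where
  gen   : ∀ i → A i → Term t A (leafNode t i)
  plus  : ∀ {v} → Term t A v → Term t A v → Term t A v
  times : ∀ {v l r} → IsParent v l r → Term t A l → Term t A r → Term t A v

-- Bracketed nonempty sums.  Sketches need not have a zero, so there is no empty sum.
data Sum⁺ (X : Set x) : Set x where
  single : X → Sum⁺ X
  _∪_    : Sum⁺ X → Sum⁺ X → Sum⁺ X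

map⁺ : {X : Set x} {Y : Set y} → (X → Y) → Sum⁺ X → Sum⁺ Y
map⁺ f (single x) = single (f x)
map⁺ f (s ∪ t)    = map⁺ f s ∪ map⁺ f t

bind⁺ : {X : Set x} {Y : Set y} → Sum⁺ X → (X → Sum⁺ Y) → Sum⁺ Y
bind⁺ (single x) f = f x
bind⁺ (s ∪ t)    f = bind⁺ s f ∪ bind⁺ t f

leaves : {X : Set x} → Sum⁺ X → List X
leaves (single x) = x ∷ []
leaves (s ∪ t)    = leaves s ++ leaves t

-- An expression, multiplied out.  No associativity or commutativity of the product
-- is involved.
expand : {t : MulTree k} {A : Fin k → Set} {v : Node t} → Term t A v → Sum⁺ (ChoiceAt v A)
expand {t = t} (gen i u) = single (choose t i u)
expand (plus T U)        = expand T ∪ expand U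
expand (times p T U)     = bind⁺ (expand T) λ c → map⁺ (pair p c) (expand U)

module _ {R : Set r} (_⊕_ _⊙_ : R → R → R) where

  -- The value of an expression whose generators have the values h.
  ⟦_⟧ᵀ : {t : MulTree k} {A : Fin k → Set} {v : Node t} → Term t A v → (∀ i → A i → R) → R
  ⟦ gen i u ⟧ᵀ     h = h i u
  ⟦ plus T U ⟧ᵀ    h = ⟦ T ⟧ᵀ h ⊕ ⟦ U ⟧ᵀ h
  ⟦ times _ T U ⟧ᵀ h = ⟦ T ⟧ᵀ h ⊙ ⟦ U ⟧ᵀ h

module _ {R : Set r} (_⊕_ : R → R → R) where

  sum⁺ : {X : Set x} → (X → R) → Sum⁺ X → R
  sum⁺ f (single x) = f x
  sum⁺ f (s ∪ t)    = sum⁺ f s ⊕ sum⁺ f t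

-- Sums in commutative semigroups

module Sums {R : Set r} {_≈_ : R → R → Set ℓ} {_⊕_ : R → R → R}
            (isCommutativeSemigroup : IsCommutativeSemigroup _≈_ _⊕_) where
  open IsCommutativeSemigroup isCommutativeSemigroup
    renaming (refl to ≈-refl; sym to ≈-sym; trans to ≈-trans; reflexive to ≈-reflexive)

  -- The sum of the list, with initial value z.
  ∑ : {X : Set x} → R → (X → R) → List X → R
  ∑ z f = List.foldr (λ x → f x ⊕_) z

  ∑-cong : {X : Set x} {z : R} {f g : X → R} → (∀ x → f x ≈ g x) → ∀ xs → ∑ z f xs ≈ ∑ z g xs
  ∑-cong eq []       = ≈-refl
  ∑-cong eq (x ∷ xs) = ∙-cong (eq x) (∑-cong eq xs)

  ∑-map : {X : Set x} {Y : Set y} (z : R) (f : Y → R) (g : X → Y) → ∀ xs →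
          ∑ z f (List.map g xs) ≡ ∑ z (f ∘ g) xs
  ∑-map z f g []       = refl
  ∑-map z f g (x ∷ xs) = cong (f (g x) ⊕_) (∑-map z f g xs)

  sum⁺-leaves : {X : Set x} (z : R) (f : X → R) → ∀ s →
                (sum⁺ _⊕_ f s ⊕ z) ≈ ∑ z f (leaves s)
  sum⁺-leaves z f (single x) = ≈-refl
  sum⁺-leaves z f (s ∪ t) = ≈-trans (assoc _ _ _)
    (≈-trans (∙-cong ≈-refl (sum⁺-leaves z f t))
    (≈-trans (sum⁺-leaves (∑ z f (leaves t)) f s)
             (≈-reflexive (sym (foldr-++ (λ x → f x ⊕_) z (leaves s) (leaves t))))))

  module _ {_⊙_ : R → R → R} (⊙-cong : AlgDefs.Congruent₂ _≈_ _⊙_)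
           (distrib : AlgDefs._DistributesOver_ _≈_ _⊙_ _⊕_) where

    sum⁺-map : {X : Set x} {Y : Set y} (u : R) (f : X → Y) (g : Y → R) (h : X → R) →
               (∀ c → g (f c) ≈ (u ⊙ h c)) → ∀ s → sum⁺ _⊕_ g (map⁺ f s) ≈ (u ⊙ sum⁺ _⊕_ h s)
    sum⁺-map u f g h eq (single c) = eq c
    sum⁺-map u f g h eq (s ∪ t) =
      ≈-trans (∙-cong (sum⁺-map u f g h eq s) (sum⁺-map u f g h eq t))
              (≈-sym (proj₁ distrib u _ _))

    sum⁺-bind : {X : Set x} {Y : Set y} (u : R) (f : X → Sum⁺ Y) (g : Y → R) (h : X → R) →
                (∀ c → sum⁺ _⊕_ g (f c) ≈ (h c ⊙ u)) → ∀ s → sum⁺ _⊕_ g (bind⁺ s f) ≈ (sum⁺ _⊕_ h s ⊙ u)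
    sum⁺-bind u f g h eq (single c) = eq c
    sum⁺-bind u f g h eq (s ∪ t) =
      ≈-trans (∙-cong (sum⁺-bind u f g h eq s) (sum⁺-bind u f g h eq t))
              (≈-sym (proj₂ distrib u _ _))

    expand-correct : {t : MulTree k} {A : Fin k → Set} (h : ∀ i → A i → R) {v : Node t}
                     (T : Term t A v) →
                     ⟦_⟧ᵀ _⊕_ _⊙_ T h ≈ sum⁺ _⊕_ (productAt _⊙_ v h) (expand T)
    expand-correct {t = t} h (gen i u) = ≈-reflexive (sym (productAt-choose _⊙_ t h i u))
    expand-correct h (plus T U) = ∙-cong (expand-correct h T) (expand-correct h U)
    expand-correct h (times p T U) =
      ≈-trans (⊙-cong (expand-correct h T) (expand-correct h U))
      (≈-sym (sum⁺-bind _ _ _ _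
        (λ c → sum⁺-map _ (pair p c) _ _
          (λ e → ≈-reflexive (productAt-pair _⊙_ h p c e)) (expand U)) (expand T)))

    -- An expression at the root is the sum of its monomials.  The summand z makes both
    -- sides nonempty sums.
    monomials-sum : {t : MulTree k} {A : Fin k → Set} (h : ∀ i → A i → R) (z : R)
                    (T : Term t A root) →
                    (⟦_⟧ᵀ _⊕_ _⊙_ T h ⊕ z)
                      ≈ ∑ z (λ β → evalTree t _⊙_ (λ i → h i (β i)))
                            (List.map (assignment t) (leaves (expand T)))
    monomials-sum {t = t} h z T =
      ≈-trans (∙-cong (expand-correct h T) ≈-refl)
      (≈-trans (sum⁺-leaves z (product _⊙_ t h) (expand T))
      (≈-trans (∑-cong (λ c → ≈-reflexive (product≡evalTree _⊙_ t h c)) (leaves (expand T)))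
               (≈-reflexive (sym (∑-map z _ (assignment t) (leaves (expand T)))))))

-- Multiplicities of elements of lists

module Multiplicities {c ℓ} (X : DecSetoid c ℓ) where
  open DecSetoid X using (_≈_; _≟_) renaming (Carrier to C; refl to ~-refl; sym to ~-sym; trans to ~-trans)

  -- The number of elements of the list equivalent to α.
  count : C → List C → ℕ
  count α = List.foldr (λ β → ind (β ≟ α) +_) 0

  count-∷ : ∀ α xs → count α (α ∷ xs) ≡ suc (count α xs)
  count-∷ α xs rewrite dec-true (α ≟ α) ~-refl = refl

  module _ {R : Set r} {_≈ᴿ_ : R → R → Set p} {_⊕_ : R → R → R}
           (isCommutativeSemigroup : IsCommutativeSemigroup _≈ᴿ_ _⊕_) where
    open IsCommutativeSemigroup isCommutativeSemigroup
      renaming (refl to ≈-refl; sym to ≈-sym; trans to ≈-trans)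
    open Sums isCommutativeSemigroup

    -- A list that contains an element equivalent to β is, for counting and for
    -- summing, a list that starts with such an element.
    extract : ∀ β xs → count β xs ≢ 0 → ∃ λ β′ → ∃ λ ys → β′ ≈ β ×
              (∀ α → count α xs ≡ ind (β′ ≟ α) + count α ys) ×
              (∀ z f → ∑ z f xs ≈ᴿ (f β′ ⊕ ∑ z f ys))
    extract β []       n≢0 = contradiction refl n≢0
    extract β (γ ∷ xs) n≢0 with γ ≟ β
    ... | yes γ~β = γ , xs , γ~β , (λ _ → refl) , λ _ _ → ≈-refl
    ... | no  γ≁β =
      let β′ , ys , β′~β , counts , sums = extract β xs n≢0
      in β′ , γ ∷ ys , β′~β ,
         (λ α → trans (cong (ind (γ ≟ α) +_) (counts α)) (+-exchange (ind (γ ≟ α)) (ind (β′ ≟ α)) _)) ,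
         λ z f → ≈-trans (∙-cong ≈-refl (sums z f))
                (≈-trans (≈-sym (assoc _ _ _))
                (≈-trans (∙-cong (comm _ _) ≈-refl) (assoc _ _ _)))
      where
      +-exchange : ∀ i j k → i + (j + k) ≡ j + (i + k)
      +-exchange i j k = trans (sym (ℕ.+-assoc i j k))
                        (trans (cong (_+ k) (ℕ.+-comm i j)) (ℕ.+-assoc j i k))

    equal-counts⇒equal-sums : ∀ {f} → (∀ {α β} → α ≈ β → f α ≈ᴿ f β) → ∀ z xs ys →
      (∀ α → count α xs ≡ count α ys) → ∑ z f xs ≈ᴿ ∑ z f ys
    equal-counts⇒equal-sums f-cong z [] [] eq = ≈-refl
    equal-counts⇒equal-sums f-cong z [] (β ∷ ys) eq =
      contradiction (trans (eq β) (count-∷ β ys)) λ ()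
    equal-counts⇒equal-sums {f} f-cong z (β ∷ xs) ys eq =
      let β′ , ys′ , β′~β , counts , sums = extract β ys
            (λ n≡0 → contradiction (trans (sym (count-∷ β xs)) (trans (eq β) n≡0)) λ ())
          rest = λ α → ℕ.+-cancelˡ-≡ (ind (β′ ≟ α)) _ _
            (trans (cong (_+ count α xs)
                     (ind-cong (~-trans (~-sym β′~β)) (~-trans β′~β) (β′ ≟ α) (β ≟ α)))
            (trans (eq α) (counts α)))
      in ≈-trans (∙-cong (f-cong (~-sym β′~β)) (equal-counts⇒equal-sums f-cong z xs ys′ rest))
                 (≈-sym (sums z f))

-- Memories and the relocation of arrays

module _ {A : Set x} (M : Memory A) (x k : ℕ) (v : A) where

  update-same : (M [ x , k ]≔ v) x k ≡ v
  update-same rewrite dec-true (x ℕ.≟ x) refl | dec-true (k ℕ.≟ k) refl = refl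

  update-otherArray : ∀ {y} → x ≢ y → ∀ l → (M [ x , k ]≔ v) y l ≡ M y l
  update-otherArray {y} x≢y l rewrite dec-false (x ℕ.≟ y) x≢y = refl

  update-otherCell : ∀ y {l} → k ≢ l → (M [ x , k ]≔ v) y l ≡ M y l
  update-otherCell y {l} k≢l rewrite dec-false (k ℕ.≟ l) k≢l with does (x ℕ.≟ y)
  ... | true  = refl
  ... | false = refl

row?-just : ∀ {n k} {r : Fin n} → row? n k ≡ just r → toℕ r ≡ k
row?-just {n} {k} eq with k ℕ.<? n
row?-just refl | yes k<n = Finₚ.toℕ-fromℕ< k<n

row?-toℕ : ∀ {n} (r : Fin n) → row? n (toℕ r) ≡ just r
row?-toℕ {n} r with toℕ r ℕ.<? n
... | yes r<n = cong just (Finₚ.fromℕ<-toℕ r r<n)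
... | no  r≮n = contradiction (Finₚ.toℕ<n r) r≮n

-- The arrays are divided into K + 1 families, called tags, by their names
-- modulo K + 1.
module Addressing (K : ℕ) where

  Tag : Set
  Tag = Fin (suc K)

  -- The name of the x-th array with tag t.
  addr : Tag → ℕ → ℕ
  addr t x = toℕ t + x * suc K

  Tagged : Tag → ℕ → Set
  Tagged t y = y % suc K ≡ toℕ t

  addr-tagged : ∀ t x → Tagged t (addr t x)
  addr-tagged t x = trans (ℕ.[m+kn]%n≡m%n (toℕ t) x (suc K)) (ℕ.m<n⇒m%n≡m (Finₚ.toℕ<n t))

  addr-injective : ∀ t {x y} → addr t x ≡ addr t y → x ≡ y
  addr-injective t {x} {y} eq = ℕ.*-cancelʳ-≡ x y (suc K) (ℕ.+-cancelˡ-≡ (toℕ t) _ _ eq)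

  tag-unique : ∀ {t u} y → Tagged t y → Tagged u y → t ≡ u
  tag-unique _ p q = Finₚ.toℕ-injective (trans (sym p) q)

  addr-otherTag : ∀ {t u} x y → t ≢ u → addr t x ≢ addr u y
  addr-otherTag {t} {u} x y t≢u eq =
    t≢u (tag-unique (addr t x) (addr-tagged t x) (subst (Tagged u) (sym eq) (addr-tagged u y)))

-- A program with its arrays moved to those with tag t, and the values of the i-th
-- factor copied from the array source i, where they are indexed by rows,
-- instead of being produced.
module Relocation {Q : Query} {K : ℕ} (t : Addressing.Tag K) (source : Fin (Query.m Q) → ℕ) where
  open Addressing K

  relocateᵉ : Exp Q → Exp Q
  relocateᵉ (lit n)    = lit n
  relocateᵉ (rowsOf i) = rowsOf i
  relocateᵉ (x [ e ])  = addr t x [ relocateᵉ e ]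
  relocateᵉ (e :+ f)   = relocateᵉ e :+ relocateᵉ f
  relocateᵉ (e :∸ f)   = relocateᵉ e :∸ relocateᵉ f

  relocateᵗ : Test Q → Test Q
  relocateᵗ (less e f)            = less (relocateᵉ e) (relocateᵉ f)
  relocateᵗ (cell< i e k j f l)   = cell< i (relocateᵉ e) k j (relocateᵉ f) l
  relocateᵗ (filled x e)          = filled (addr t x) (relocateᵉ e)

  relocate : Cmd Q (Factor Q) → Cmd Q (Sketching Q)
  relocate skip                       = skip
  relocate (word x e f)               = word (addr t x) (relocateᵉ e) (relocateᵉ f)
  relocate (produce x e (factor i f)) = copy (addr t x) (relocateᵉ e) (source i) (relocateᵉ f)
  relocate (copy x e y f)             = copy (addr t x) (relocateᵉ e) (addr t y) (relocateᵉ f)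
  relocate (add x e y f z g)          =
    add (addr t x) (relocateᵉ e) (addr t y) (relocateᵉ f) (addr t z) (relocateᵉ g)
  relocate (mul x e y f z g)          =
    mul (addr t x) (relocateᵉ e) (addr t y) (relocateᵉ f) (addr t z) (relocateᵉ g)
  relocate (p ⨾ q)                    = relocate p ⨾ relocate q
  relocate (branch c p q)             = branch (relocateᵗ c) (relocate p) (relocate q)
  relocate (while c p)                = while (relocateᵗ c) (relocate p)

-- Replaying a run on sketches

-- A run of a program on elements of a commutative semiring S, with weights g, is
-- matched by a run of the relocated program on sketches, where h i r takes the
-- place of the weight of row r of table i.
module Simulation
  {c ℓ₁ ℓ₂ s ℓS r ℓ} {𝕊 : Scalars c ℓ₁ ℓ₂} {Q : Query} (I : Tables 𝕊 Q)
  {ρ : MulTree (Query.m Q)} (Sk : DBSketch 𝕊 (Query.d Q) (Join.∣D∣ I) ρ r ℓ)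
  (T⊕ T⊙ T_f : ℕ) .{{_ : NonZero T⊕}} .{{_ : NonZero T⊙}}
  (S : CommutativeSemiring s ℓS) (g : Join.Weights I S)
  (nodeOf : ℕ → Node ρ)
  {K : ℕ} (t : Addressing.Tag K) (source : Fin (Query.m Q) → ℕ)
  (h : ∀ i → Fin (Tables.size I i) → DBSketch.Carrier Sk)
  where
  open Query Q
  open Tables I
  open Semantics I
  open Addressing K
  open Relocation {Q} t source
  private
    module S = CommutativeSemiring S
    module Sk = DBSketch Sk
    VS = faqValues S g
    VR = sketchValues Sk T⊕ T⊙ T_f

  -- Expressions whose generators are the rows of the tables.
  RowTerm : Node ρ → Set
  RowTerm = Term ρ (Fin ∘ size)

  ⟦_⟧S : ∀ {v} → RowTerm v → S.Carrier
  ⟦ T ⟧S = ⟦_⟧ᵀ S._+_ S._*_ T (λ i r → g i (table i r))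

  ⟦_⟧R : ∀ {v} → RowTerm v → Sk.Carrier
  ⟦ T ⟧R = ⟦_⟧ᵀ Sk._⊕_ Sk._⊙_ T h

  -- Corresponding cells are both empty, or hold the values of one expression.
  data Related (v : Node ρ) : Maybe S.Carrier → Maybe Sk.Carrier → Set (s ⊔ r) where
    empty : Related v nothing nothing
    value : (T : RowTerm v) → Related v (just ⟦ T ⟧S) (just ⟦ T ⟧R)

  -- σ′ holds the state σ in its arrays with tag t, and agrees with σ₀ elsewhere.
  record Simulates (σ₀ : State VR) (σ : State VS) (σ′ : State VR) : Set (s ⊔ r) where
    field
      words       : ∀ x k → proj₁ σ′ (addr t x) k ≡ proj₁ σ x k
      cells       : ∀ x k → Related (nodeOf x) (proj₂ σ x k) (proj₂ σ′ (addr t x) k)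
      words-frame : ∀ {y} → ¬ Tagged t y → ∀ k → proj₁ σ′ y k ≡ proj₁ σ₀ y k
      cells-frame : ∀ {y} → ¬ Tagged t y → ∀ k → proj₂ σ′ y k ≡ proj₂ σ₀ y k
  open Simulates

  private variable
    σ₀ σ′ : State VR
    w w′  : Memory ℕ
    u     : Memory (Maybe S.Carrier)
    u′    : Memory (Maybe Sk.Carrier)

  set-word : ∀ x k n → Simulates σ₀ (w , u) (w′ , u′) →
             Simulates σ₀ (w [ x , k ]≔ n , u) (w′ [ addr t x , k ]≔ n , u′)
  set-word {σ₀} {w} {u} {w′} {u′} x k n sim = record
    { words       = set
    ; cells       = cells sim
    ; words-frame = λ {y} ¬t l →
        trans (update-otherArray w′ (addr t x) k n (λ { refl → ¬t (addr-tagged t x) }) l) (words-frame sim ¬t l)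
    ; cells-frame = cells-frame sim
    }
    where
    set : ∀ y l → (w′ [ addr t x , k ]≔ n) (addr t y) l ≡ (w [ x , k ]≔ n) y l
    set y l with x ℕ.≟ y | k ℕ.≟ l
    ... | yes refl | yes refl = trans (update-same w′ _ k n) (sym (update-same w x k n))
    ... | no  x≢y  | _        = trans (update-otherArray w′ _ k n (x≢y ∘ addr-injective t) l)
                                (trans (words sim y l) (sym (update-otherArray w x k n x≢y l)))
    ... | _        | no k≢l   = trans (update-otherCell w′ (addr t x) k n (addr t y) k≢l)
                                (trans (words sim y l) (sym (update-otherCell w x k n y k≢l)))

  set-cell : ∀ x k {a b} → Related (nodeOf x) a b → Simulates σ₀ (w , u) (w′ , u′) →
             Simulates σ₀ (w , u [ x , k ]≔ a) (w′ , u′ [ addr t x , k ]≔ b)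
  set-cell {σ₀} {w} {u} {w′} {u′} x k {a} {b} rel sim = record
    { words       = words sim
    ; cells       = set
    ; words-frame = words-frame sim
    ; cells-frame = λ {y} ¬t l →
        trans (update-otherArray u′ (addr t x) k b (λ { refl → ¬t (addr-tagged t x) }) l) (cells-frame sim ¬t l)
    }
    where
    set : ∀ y l → Related (nodeOf y) ((u [ x , k ]≔ a) y l) ((u′ [ addr t x , k ]≔ b) (addr t y) l)
    set y l with x ℕ.≟ y | k ℕ.≟ l
    ... | yes refl | yes refl
      rewrite update-same u x k a | update-same u′ (addr t x) k b = rel
    ... | no x≢y | _
      rewrite update-otherArray u x k a x≢y l
            | update-otherArray u′ (addr t x) k b (x≢y ∘ addr-injective t) l = cells sim y l
    ... | _ | no k≢l
      rewrite update-otherCell u x k a y k≢l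
            | update-otherCell u′ (addr t x) k b (addr t y) k≢l = cells sim y l

  exp-value : ∀ e → Simulates σ₀ (w , u) (w′ , u′) → ⟦ relocateᵉ e ⟧ w′ ≡ ⟦ e ⟧ w
  exp-value (lit n)             sim = refl
  exp-value (rowsOf i)          sim = refl
  exp-value {w′ = w′} (x [ e ]) sim = trans (cong (w′ (addr t x)) (exp-value e sim)) (words sim x _)
  exp-value (e :+ f)            sim = cong₂ _+_ (exp-value e sim) (exp-value f sim)
  exp-value (e :∸ f)            sim = cong₂ _∸_ (exp-value e sim) (exp-value f sim)

  exp-cost : ∀ e → ∣ relocateᵉ e ∣ ≡ ∣ e ∣
  exp-cost (lit n)    = refl
  exp-cost (rowsOf i) = refl
  exp-cost (x [ e ])  = cong suc (exp-cost e)
  exp-cost (e :+ f)   = cong₂ (λ i j → 1 + i + j) (exp-cost e) (exp-cost f)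
  exp-cost (e :∸ f)   = cong₂ (λ i j → 1 + i + j) (exp-cost e) (exp-cost f)

  related-filled : ∀ {v a b} → Related v a b → is-just b ≡ is-just a
  related-filled empty     = refl
  related-filled (value _) = refl

  test-value : ∀ C → Simulates σ₀ (w , u) (w′ , u′) → test w′ u′ (relocateᵗ C) ≡ test w u C
  test-value (less e f) sim
    rewrite exp-value e sim | exp-value f sim = refl
  test-value (cell< i e k j f l) sim
    rewrite exp-value e sim | exp-value f sim = refl
  test-value (filled x e) sim
    rewrite exp-value e sim = cong just (related-filled (cells sim x _))

  test-cost : ∀ C → cost-test (relocateᵗ C) ≡ cost-test C
  test-cost (less e f)          = cong₂ (λ i j → 1 + i + j) (exp-cost e) (exp-cost f)
  test-cost (cell< i e k j f l) = cong₂ (λ i j → 1 + i + j) (exp-cost e) (exp-cost f)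
  test-cost (filled x e)        = cong suc (exp-cost e)

  related-value : ∀ {v a b} → Related v a b → ∀ {a′} → a ≡ just a′ →
                  ∃ λ (T : RowTerm v) → a′ ≡ ⟦ T ⟧S × b ≡ just ⟦ T ⟧R
  related-value (value T) refl = T , refl , refl

  -- The cost of an operation on semiring elements is 1.
  slowdown : ℕ
  slowdown = T⊙ + T⊕

  private
    1≤slowdown : 1 ≤ slowdown
    1≤slowdown = ℕ.≤-trans (>-nonZero⁻¹ T⊕) (ℕ.m≤n+m T⊕ T⊙)

    scale : ∀ n → n ≤ slowdown * n
    scale n = ℕ.≤-trans (ℕ.≤-reflexive (sym (ℕ.*-identityˡ n))) (ℕ.*-monoˡ-≤ n 1≤slowdown)

    more : ∀ {a b a′ b′} → a ≤ slowdown * b → a′ ≤ slowdown * b′ → a + a′ ≤ slowdown * (b + b′)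
    more {b = b} {b′ = b′} p q =
      ℕ.≤-trans (ℕ.+-mono-≤ p q) (ℕ.≤-reflexive (sym (ℕ.*-distribˡ-+ slowdown b b′)))

    operation : ∀ T e f g → T ≤ slowdown →
                T + ∣ relocateᵉ e ∣ + ∣ relocateᵉ f ∣ + ∣ relocateᵉ g ∣
                  ≤ slowdown * (1 + ∣ e ∣ + ∣ f ∣ + ∣ g ∣)
    operation T e f g T≤ rewrite exp-cost e | exp-cost f | exp-cost g =
      more (more (more (ℕ.≤-trans T≤ (ℕ.≤-reflexive (sym (ℕ.*-identityʳ slowdown))))
                       (scale ∣ e ∣)) (scale ∣ f ∣)) (scale ∣ g ∣)

  module _ (σ₀ : State VR)
           (source-untagged : ∀ i → ¬ Tagged t (source i))
           (source-value : ∀ i r → proj₂ σ₀ (source i) (toℕ r) ≡ just (h i r)) where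

    simulate : ∀ {p σ T σ₁} → Follows Q ρ nodeOf p → Run VS p σ T σ₁ →
               ∀ {σ′} → Simulates σ₀ σ σ′ →
               ∃ λ T′ → ∃ λ σ₁′ → Run VR (relocate p) σ′ T′ σ₁′ ×
               Simulates σ₀ σ₁ σ₁′ × T′ ≤ slowdown * T
    simulate follows skip sim = _ , _ , skip , sim , scale 1
    simulate follows (word {x = x} {e} {f}) {w′ , u′} sim
      = _ , _ , word ,
        subst (λ (k , n) → Simulates σ₀ _ (w′ [ addr t x , k ]≔ n , u′))
              (sym (cong₂ _,_ (exp-value e sim) (exp-value f sim)))
              (set-word x (⟦ e ⟧ _) (⟦ f ⟧ _) sim) ,
        ℕ.≤-trans (ℕ.≤-reflexive (cong₂ (λ i j → 1 + i + j) (exp-cost e) (exp-cost f))) (scale _)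
    simulate follows (produce {w} {u} {x} {e} {factor i f} eq) {w′ , u′} sim
      with row? (size i) (⟦ f ⟧ w) in row | eq
    ... | just r | refl =
      _ , _ , copy found ,
      subst (λ k → Simulates σ₀ _ (w′ , u′ [ addr t x , k ]≔ just (h i r)))
            (sym (exp-value e sim))
            (set-cell x (⟦ e ⟧ _) (subst (λ v → Related v (just (g i (table i r))) (just (h i r)))
                                 (sym follows) (value (gen i r))) sim) ,
      ℕ.≤-trans (ℕ.≤-reflexive cost) (scale _)
      where
      found : u′ (source i) (⟦ relocateᵉ f ⟧ w′) ≡ just (h i r)
      found = trans (cells-frame sim (source-untagged i) _)
             (trans (cong (proj₂ σ₀ (source i)) (trans (exp-value f sim) (sym (row?-just row))))
                    (source-value i r))
      cost : 1 + ∣ relocateᵉ e ∣ + ∣ relocateᵉ f ∣ ≡ 1 + ∣ f ∣ + ∣ e ∣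
      cost = trans (cong₂ (λ i j → 1 + i + j) (exp-cost e) (exp-cost f))
                   (cong suc (ℕ.+-comm ∣ e ∣ ∣ f ∣))
    simulate follows (copy {w} {u} {x} {e} {y} {f} eq) {w′ , u′} sim
      with T , refl , found ← related-value (cells sim y _) eq =
      _ , _ , copy (trans (cong (u′ (addr t y)) (exp-value f sim)) found) ,
      subst (λ k → Simulates σ₀ _ (w′ , u′ [ addr t x , k ]≔ just ⟦ T ⟧R))
            (sym (exp-value e sim))
            (set-cell x (⟦ e ⟧ _) (moved follows T) sim) ,
      ℕ.≤-trans (ℕ.≤-reflexive (cong₂ (λ i j → 1 + i + j) (exp-cost e) (exp-cost f))) (scale _)
      where
      moved : ∀ {v l} → v ≡ l → (T : RowTerm l) → Related v (just ⟦ T ⟧S) (just ⟦ T ⟧R)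
      moved refl T = value T
    simulate follows (add {w} {u} {x} {e} {y} {f} {z} {g} eq₁ eq₂) {w′ , u′} sim
      with T , refl , found₁ ← related-value (cells sim y _) eq₁
         | U , refl , found₂ ← related-value (cells sim z _) eq₂ =
      _ , _ , add (trans (cong (u′ (addr t y)) (exp-value f sim)) found₁)
                  (trans (cong (u′ (addr t z)) (exp-value g sim)) found₂) ,
      subst (λ k → Simulates σ₀ _ (w′ , u′ [ addr t x , k ]≔ just (⟦ T ⟧R Sk.⊕ ⟦ U ⟧R)))
            (sym (exp-value e sim))
            (set-cell x (⟦ e ⟧ _) (added follows T U) sim) ,
      operation T⊕ e f g (ℕ.m≤n+m T⊕ T⊙)
      where
      added : ∀ {v l r} → v ≡ l × v ≡ r → (T : RowTerm l) (U : RowTerm r) →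
              Related v (just (⟦ T ⟧S S.+ ⟦ U ⟧S)) (just (⟦ T ⟧R Sk.⊕ ⟦ U ⟧R))
      added (refl , refl) T U = value (plus T U)
    simulate follows (mul {w} {u} {x} {e} {y} {f} {z} {g} eq₁ eq₂) {w′ , u′} sim
      with T , refl , found₁ ← related-value (cells sim y _) eq₁
         | U , refl , found₂ ← related-value (cells sim z _) eq₂ =
      _ , _ , mul (trans (cong (u′ (addr t y)) (exp-value f sim)) found₁)
                  (trans (cong (u′ (addr t z)) (exp-value g sim)) found₂) ,
      subst (λ k → Simulates σ₀ _ (w′ , u′ [ addr t x , k ]≔ just (⟦ T ⟧R Sk.⊙ ⟦ U ⟧R)))
            (sym (exp-value e sim))
            (set-cell x (⟦ e ⟧ _) (value (times follows T U)) sim) ,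
      operation T⊙ e f g (ℕ.m≤m+n T⊙ T⊕)
    simulate (follows₁ , follows₂) (seq run₁ run₂) sim =
      let _ , _ , run₁′ , sim₁ , T₁ = simulate follows₁ run₁ sim
          _ , _ , run₂′ , sim₂ , T₂ = simulate follows₂ run₂ sim₁
      in _ , _ , seq run₁′ run₂′ , sim₂ , more T₁ T₂
    simulate (follows , _) (branch {true} {C} eq run) sim =
      let _ , _ , run′ , sim′ , T = simulate follows run sim
      in _ , _ , branch (trans (test-value C sim) eq) run′ , sim′ ,
         more (ℕ.≤-trans (ℕ.≤-reflexive (test-cost C)) (scale _)) T
    simulate (_ , follows) (branch {false} {C} eq run) sim =
      let _ , _ , run′ , sim′ , T = simulate follows run sim
      in _ , _ , branch (trans (test-value C sim) eq) run′ , sim′ ,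
         more (ℕ.≤-trans (ℕ.≤-reflexive (test-cost C)) (scale _)) T
    simulate follows (stop {C} eq) sim =
      _ , _ , stop (trans (test-value C sim) eq) , sim ,
      ℕ.≤-trans (ℕ.≤-reflexive (test-cost C)) (scale _)
    simulate follows (loop {C} eq run₁ run₂) sim =
      let _ , _ , run₁′ , sim₁ , T₁ = simulate follows run₁ sim
          _ , _ , run₂′ , sim₂ , T₂ = simulate follows run₂ sim₁
      in _ , _ , loop (trans (test-value C sim) eq) run₁′ run₂′ , sim₂ ,
         more (more (ℕ.≤-trans (ℕ.≤-reflexive (test-cost C)) (scale _)) T₁) T₂

-- Mixed-radix digits, and lists without repetitions

module _ {A : Set x} {P : Set p} (P? : Dec P) {u v : A} where

  if-yes : P → (if does P? then u else v) ≡ u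
  if-yes p = cong (if_then u else v) (dec-true P? p)

  if-no : ¬ P → (if does P? then u else v) ≡ v
  if-no ¬p = cong (if_then u else v) (dec-false P? ¬p)

digits-injective : ∀ {m} (ks : Vector ℕ m) x y →
                   (∀ i → digits ks x i ≡ digits ks y i) → x ≡ y
digits-injective {zero}  ks zero zero eq = refl
digits-injective {suc m} ks x    y    eq = begin
  x                                                ≡⟨ Finₚ.combine-remQuot {k₀} K x ⟨
  combine (quotient {k₀} K x) (remainder {k₀} K x) ≡⟨ cong₂ combine (eq zero)
                                                       (digits-injective (tail ks) _ _ (eq ∘ suc)) ⟩
  combine (quotient {k₀} K y) (remainder {k₀} K y) ≡⟨ Finₚ.combine-remQuot {k₀} K y ⟩
  y                                                ∎
  where
  open ≡-Reasoning
  k₀ = ks zero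
  K  = ∏ (tail ks)

∏-ones : ∀ {m} (ks : Vector ℕ m) → (∀ i → ks i ≡ 1) → ∏ ks ≡ 1
∏-ones {zero}  ks eq = refl
∏-ones {suc m} ks eq rewrite eq zero | ∏-ones (tail ks) (eq ∘ suc) = refl

-- If all factors of a Kronecker product but the i-th have a single column, then its
-- columns are those of the i-th factor (∏-single, digits-single).
∏-single : ∀ {m} (ks : Vector ℕ m) i → (∀ j → j ≢ i → ks j ≡ 1) → ∏ ks ≡ ks i
∏-single {suc m} ks zero eq
  rewrite ∏-ones (tail ks) (λ i → eq (suc i) λ ()) = ℕ.*-identityʳ (ks zero)
∏-single {suc m} ks (suc i) eq
  rewrite eq zero (λ ()) | ∏-single (tail ks) i (λ j j≢i → eq (suc j) (j≢i ∘ Finₚ.suc-injective)) =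
  ℕ.+-identityʳ (ks (suc i))

Fin1-toℕ : ∀ {n} → n ≡ 1 → (z : Fin n) → toℕ z ≡ 0
Fin1-toℕ refl zero = refl

digits-single : ∀ {m} (ks : Vector ℕ m) i → (∀ j → j ≢ i → ks j ≡ 1) →
                ∀ z → toℕ (digits ks z i) ≡ toℕ z
digits-single {suc m} ks i eq z = trans (digit i eq) (sym value)
  where
  open ≡-Reasoning
  K = ∏ (tail ks)
  hi : Fin (ks zero)
  hi = quotient K z
  lo : Fin K
  lo = remainder {ks zero} K z
  value : toℕ z ≡ K * toℕ hi + toℕ lo
  value = trans (sym (cong toℕ (Finₚ.combine-remQuot {ks zero} K z))) (Finₚ.toℕ-combine hi lo)
  digit : ∀ i → (∀ j → j ≢ i → ks j ≡ 1) → toℕ (digits ks z i) ≡ K * toℕ hi + toℕ lo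
  digit zero eq = begin
    toℕ hi               ≡⟨ ℕ.+-identityʳ _ ⟨
    toℕ hi + 0           ≡⟨ ℕ.+-identityʳ _ ⟨
    1 * toℕ hi + 0       ≡⟨ cong₂ (λ k l → k * toℕ hi + l) (sym K≡1) (sym (Fin1-toℕ K≡1 lo)) ⟩
    K * toℕ hi + toℕ lo   ∎
    where
    K≡1 : K ≡ 1
    K≡1 = ∏-ones (tail ks) (λ j → eq (suc j) λ ())
  digit (suc i) eq = begin
    toℕ (digits (tail ks) lo i)
      ≡⟨ digits-single (tail ks) i (λ j j≢i → eq (suc j) (j≢i ∘ Finₚ.suc-injective)) lo ⟩
    toℕ lo
      ≡⟨ cong (_+ toℕ lo) (ℕ.*-zeroʳ K) ⟨
    K * 0 + toℕ lo
      ≡⟨ cong (λ n → K * n + toℕ lo) (Fin1-toℕ (eq zero λ ()) hi) ⟨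
    K * toℕ hi + toℕ lo ∎

module _ {A : Set x} {_≈_ : A → A → Set ℓ} where

  unique-lookup : ∀ {xs : List A} → (∀ {u v} → u ≈ v → v ≈ u) → AllPairs (λ u v → ¬ u ≈ v) xs →
                  ∀ i j → List.lookup xs i ≈ List.lookup xs j → i ≡ j
  unique-lookup ≈-sym (u≉ ∷ us) zero    zero    eq = refl
  unique-lookup ≈-sym (u≉ ∷ us) zero    (suc j) eq = contradiction eq (All.lookup u≉ (∈-lookup j))
  unique-lookup ≈-sym (u≉ ∷ us) (suc i) zero    eq = contradiction (≈-sym eq) (All.lookup u≉ (∈-lookup i))
  unique-lookup ≈-sym (u≉ ∷ us) (suc i) (suc j) eq = cong suc (unique-lookup ≈-sym us i j eq)

-- A predicate on pairs that is confined to a single row of a grid.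
module _ {A : Set x} {B : Set y} {P : Pred (A × B) p} (P? : Decidable P)
         (same-row : ∀ {u v u′ v′} → P (u , v) → P (u′ , v′) → u ≡ u′) where

  length-filter-row : ∀ {us} → Unique us → ∀ vs → length (filter P? (cartesianProduct us vs)) ≤ length vs
  length-filter-row []                         vs = z≤n
  length-filter-row {u ∷ us} (u∉us ∷ unique) vs = begin
    length (filter P? (row ++ rest))                ≡⟨ cong length (filter-++ P? row rest) ⟩
    length (filter P? row ++ filter P? rest)        ≡⟨ length-++ (filter P? row) ⟩
    length (filter P? row) + length (filter P? rest) ≤⟨ bound (filter P? row) refl ⟩
    length vs                                       ∎
    where
    open ℕ.≤-Reasoning
    row rest : List (A × B)
    row  = List.map (u ,_) vs
    rest = cartesianProduct us vs
    bound : ∀ ws → filter P? row ≡ ws → length ws + length (filter P? rest) ≤ length vs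
    bound []       eq = length-filter-row unique vs
    bound (w ∷ ws) eq
      with w∈ , Pw ← ∈-filter⁻ P? {xs = row} (subst (w ∈_) (sym eq) (here refl))
      with v , _ , refl ← ∈-map⁻ (u ,_) w∈ = begin
      length (w ∷ ws) + length (filter P? rest) ≡⟨ cong₂ (λ us vs → length us + length vs) (sym eq) none ⟩
      length (filter P? row) + 0                ≡⟨ ℕ.+-identityʳ _ ⟩
      length (filter P? row)                    ≤⟨ length-filter P? row ⟩
      length row                                ≡⟨ length-map (u ,_) vs ⟩
      length vs                                 ∎
      where
      none : filter P? rest ≡ []
      none = filter-none P? (All.tabulate λ {(u′ , v′)} ∈rest Pz′ →
        contradiction (same-row Pw Pz′) (All.lookup u∉us (proj₁ (∈-cartesianProduct⁻ us vs ∈rest))))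

-- Products and sums of scalars

module Ring {c ℓ₁ ℓ₂} (𝕊 : Scalars c ℓ₁ ℓ₂) where
  open Scalars 𝕊 using (Carrier; _≈_; 0#; 1#; *-cong; *-congˡ; *-congʳ; zeroˡ; zeroʳ; +-cong;
    *-identityˡ; *-identityʳ; +-identityˡ)
    renaming (_+_ to _+ˢ_; _*_ to _*ˢ_; refl to ≈-refl; sym to ≈-sym; trans to ≈-trans;
              reflexive to ≈-reflexive)

  +-isCommutativeSemigroup : IsCommutativeSemigroup _≈_ _+ˢ_
  +-isCommutativeSemigroup =
    CommutativeMonoid.isCommutativeSemigroup (Scalars.+-commutativeMonoid 𝕊)

  open Sums +-isCommutativeSemigroup public

  product-zero : ∀ {m} (f : Vector Carrier m) i → f i ≈ 0# → Vector.foldr _*ˢ_ 1# f ≈ 0#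
  product-zero {suc m} f zero    eq = ≈-trans (*-congʳ eq) (zeroˡ _)
  product-zero {suc m} f (suc i) eq = ≈-trans (*-congˡ (product-zero (tail f) i eq)) (zeroʳ _)

  product-ones : ∀ {m} (f : Vector Carrier m) → (∀ i → f i ≈ 1#) → Vector.foldr _*ˢ_ 1# f ≈ 1#
  product-ones {zero}  f eq = ≈-refl
  product-ones {suc m} f eq =
    ≈-trans (*-cong (eq zero) (product-ones (tail f) (eq ∘ suc))) (*-identityˡ 1#)

  product-single : ∀ {m} (f : Vector Carrier m) i → (∀ j → j ≢ i → f j ≈ 1#) →
                   Vector.foldr _*ˢ_ 1# f ≈ f i
  product-single {suc m} f zero    eq =
    ≈-trans (*-congˡ (product-ones (tail f) (λ j → eq (suc j) λ ()))) (*-identityʳ _)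
  product-single {suc m} f (suc i) eq =
    ≈-trans (*-cong (eq zero λ ())
                    (product-single (tail f) i λ j j≢i → eq (suc j) (j≢i ∘ Finₚ.suc-injective)))
            (*-identityˡ _)

  ∑-none : ∀ {n} (z : Carrier) (f : Fin n → Carrier) y {xs} → All (_≢ y) xs →
           ∑ z (λ x → if does (x Finₚ.≟ y) then f x else 0#) xs ≈ z
  ∑-none z f y []                   = ≈-refl
  ∑-none z f y (_∷_ {x} x≢y others) =
    ≈-trans (+-cong (≈-reflexive (if-no (x Finₚ.≟ y) x≢y)) (∑-none z f y others)) (+-identityˡ z)

  ∑-single : ∀ {n} (z : Carrier) (f : Fin n → Carrier) {y xs} → Unique xs → y ∈ xs →
             ∑ z (λ x → if does (x Finₚ.≟ y) then f x else 0#) xs ≈ (f y +ˢ z)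
  ∑-single z f {y} (y∉ ∷ _) (here refl) =
    +-cong (≈-reflexive (if-yes (y Finₚ.≟ y) refl))
           (∑-none z f y (All.map (λ y≢x x≡y → y≢x (sym x≡y)) y∉))
  ∑-single z f {y} (_∷_ {x} x∉ unique) (there y∈) =
    ≈-trans (+-cong (≈-reflexive (if-no (x Finₚ.≟ y) (All.lookup x∉ y∈))) (∑-single z f unique y∈))
            (+-identityˡ _)

-- Leaf matrices, and the decomposition of J

module LeafEntries (Q : Query) where
  open Query Q

  -- Each row of a table has two leaf matrices: one with a single column, which marks
  -- the element of Dⱼ that the row projects to, and one with the d columns of J, which
  -- contains the row itself.  They are distinguished by false and true.
  width : Bool → ℕ
  width true  = d
  width false = 1

  -- The cells of the row e of table j in those columns among ys that are assigned to j.
  columnEntries : ∀ j → Exp Q → List (Fin d) → List (Exp Q × Fin d × Entry Q j)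
  columnEntries j e []       = []
  columnEntries j e (y ∷ ys) with assign y Finₚ.≟ j
  ... | yes refl = (e , y , cell e (proj₁ (assigned y))) ∷ columnEntries j e ys
  ... | no  _    = columnEntries j e ys

  leafEntries : ∀ b j → Exp Q → List (Exp Q × Fin (width b) × Entry Q j)
  leafEntries true  j e = columnEntries j e (allFin d)
  leafEntries false j e = (e , zero , one) ∷ []

  -- The numbers of columns of the factors that make up a row of the i-th block.
  widths : Fin m → Vector ℕ m
  widths i j = width (does (j Finₚ.≟ i))

  widths-1 : ∀ i j → j ≢ i → widths i j ≡ 1
  widths-1 i j j≢i = cong width (dec-false (j Finₚ.≟ i) j≢i)

  d≡∏widths : ∀ i → d ≡ ∏ (widths i)
  d≡∏widths i = sym (trans (∏-single (widths i) i (widths-1 i)) (cong width (dec-true (i Finₚ.≟ i) refl)))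

module LeafMatrices {c ℓ₁ ℓ₂} {𝕊 : Scalars c ℓ₁ ℓ₂} {Q : Query} (I : Tables 𝕊 Q) where
  open Scalars 𝕊 using (Carrier; _≈_; _≟_; 0#; 1#; +-cong; +-identityˡ; +-identityʳ)
    renaming (refl to ≈-refl; sym to ≈-sym; trans to ≈-trans; reflexive to ≈-reflexive)
  open Matrices 𝕊
  open Query Q
  open Tables I
  open Join I
  open Semantics I
  open Ring 𝕊
  open LeafEntries Q public

  -- The matrices described by columnEntries and leafEntries (matrix-leafEntries).
  columnMatrix : ∀ j → Fin (size j) → List (Fin d) → Matrix (∣D∣ j) d
  columnMatrix j r []       = λ _ _ → 0#
  columnMatrix j r (y ∷ ys) with assign y Finₚ.≟ j
  ... | yes refl = unitMatrix j r y (table j r (proj₁ (assigned y))) +ᴹ columnMatrix j r ys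
  ... | no  _    = columnMatrix j r ys

  leafMatrix : ∀ b j → Fin (size j) → Matrix (∣D∣ j) (width b)
  leafMatrix true  j r = columnMatrix j r (allFin d)
  leafMatrix false j r = unitMatrix j r zero 1# +ᴹ λ _ _ → 0#

  module _ {w : Memory ℕ} {j} {e : Exp Q} {r : Fin (size j)} (e≡r : ⟦ e ⟧ w ≡ toℕ r) where

    row-found : row? (size j) (⟦ e ⟧ w) ≡ just r
    row-found = trans (cong (row? (size j)) e≡r) (row?-toℕ r)

    matrix-columnEntries : ∀ ys → matrix w j (columnEntries j e ys) ≡ just (columnMatrix j r ys)
    matrix-columnEntries []       = refl
    matrix-columnEntries (y ∷ ys) with assign y Finₚ.≟ j
    ... | yes refl rewrite row-found | matrix-columnEntries ys = refl
    ... | no  _    = matrix-columnEntries ys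

    matrix-leafEntries : ∀ b → matrix w j (leafEntries b j e) ≡ just (leafMatrix b j r)
    matrix-leafEntries true  = matrix-columnEntries (allFin d)
    matrix-leafEntries false rewrite row-found = refl

  entriesCost : ∀ {j k} → List (Exp Q × Fin k × Entry Q j) → ℕ
  entriesCost = List.sum ∘ List.map (λ (e , _ , a) → ∣ e ∣ + ∣ a ∣ₑ)

  columnEntries-cost : ∀ j e ys → entriesCost (columnEntries j e ys) ≤ length ys * (1 + ∣ e ∣ + ∣ e ∣)
  columnEntries-cost j e []       = z≤n
  columnEntries-cost j e (y ∷ ys) with assign y Finₚ.≟ j
  ... | yes refl = ℕ.+-mono-≤ (ℕ.≤-reflexive (ℕ.+-suc ∣ e ∣ ∣ e ∣)) (columnEntries-cost j e ys)
  ... | no  _    = ℕ.≤-trans (columnEntries-cost j e ys) (ℕ.m≤n+m _ _)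

  leafEntries-cost : ∀ b j e → entriesCost (leafEntries b j e) ≤ width b * (1 + ∣ e ∣ + ∣ e ∣)
  leafEntries-cost true  j e =
    ℕ.≤-trans (columnEntries-cost j e (allFin d))
              (ℕ.≤-reflexive (cong (_* (1 + ∣ e ∣ + ∣ e ∣)) (length-tabulate {n = d} (λ y → y))))
  leafEntries-cost false j e = ℕ.+-monoˡ-≤ 0
    (ℕ.≤-trans (ℕ.≤-reflexive (ℕ.+-comm ∣ e ∣ 1)) (s≤s (ℕ.m≤m+n ∣ e ∣ ∣ e ∣)))

  -- The x-th element of Dⱼ is the projection of the r-th row of table j.
  Designates : ∀ j → Fin (∣D∣ j) → Fin (size j) → Set ℓ₁
  Designates j x r = Agree (List.lookup (D j) x) (proj j r)

  designates? : ∀ j x r → Dec (Designates j x r)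
  designates? j x r = agree? (List.lookup (D j) x) (proj j r)

  lookup-D-injective : ∀ j x y → Agree (List.lookup (D j) x) (List.lookup (D j) y) → x ≡ y
  lookup-D-injective j x y =
    unique-lookup {_≈_ = Agree {j}} (λ eq e → ≈-sym (eq e)) (Unique.deduplicate-! decSetoid (List.tabulate (proj j))) x y
    where
    decSetoid : DecSetoid c ℓ₁
    decSetoid = record
      { Carrier = E j → Carrier
      ; _≈_     = Agree
      ; isDecEquivalence = record
        { isEquivalence = record
          { refl  = λ _ → ≈-refl
          ; sym   = λ eq e → ≈-sym (eq e)
          ; trans = λ eq eq′ e → ≈-trans (eq e) (eq′ e)
          }
        ; _≟_ = agree?
        }
      }

  designates-unique : ∀ j {x y r} → Designates j x r → Designates j y r → x ≡ y
  designates-unique j {x} {y} x↦r y↦r =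
    lookup-D-injective j x y (λ e → ≈-trans (x↦r e) (≈-sym (y↦r e)))

  -- The entry in column y of the row that table j contributes to J.
  cellAt : ∀ j → Fin (size j) → Fin d → Carrier
  cellAt j r y with assign y Finₚ.≟ j
  ... | yes refl = table j r (proj₁ (assigned y))
  ... | no  _    = 0#

  unitMatrix-no : ∀ j {r k x} {y : Fin k} {a} y′ → ¬ Designates j x r → unitMatrix j r y a x y′ ≡ 0#
  unitMatrix-no j {r} {x = x} {y} y′ ¬des =
    if-no (designates? j x r ×-dec (y Finₚ.≟ y′)) (¬des ∘ proj₁)

  unitMatrix-yes : ∀ j {r k x} {y : Fin k} {a} y′ → Designates j x r →
                   unitMatrix j r y a x y′ ≡ (if does (y Finₚ.≟ y′) then a else 0#)
  unitMatrix-yes j {r} {x = x} {y} y′ des rewrite dec-true (designates? j x r) des = refl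

  columnMatrix-no : ∀ j {r x} → ¬ Designates j x r → ∀ ys y → columnMatrix j r ys x y ≈ 0#
  columnMatrix-no j ¬des []        y = ≈-refl
  columnMatrix-no j {r} ¬des (y′ ∷ ys) y with assign y′ Finₚ.≟ j
  ... | yes refl = ≈-trans (+-cong (≈-reflexive (unitMatrix-no j {y = y′} y ¬des)) (columnMatrix-no j ¬des ys y))
                           (+-identityˡ 0#)
  ... | no  _    = columnMatrix-no j ¬des ys y

  columnMatrix-yes : ∀ j {r x} → Designates j x r → ∀ ys y →
    columnMatrix j r ys x y ≈ ∑ 0# (λ y′ → if does (y′ Finₚ.≟ y) then cellAt j r y′ else 0#) ys
  columnMatrix-yes j des []        y = ≈-refl
  columnMatrix-yes j {r} des (y′ ∷ ys) y with assign y′ Finₚ.≟ j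
  ... | yes refl = +-cong (≈-reflexive (unitMatrix-yes j {y = y′} y des)) (columnMatrix-yes j des ys y)
  ... | no  _    = ≈-trans (columnMatrix-yes j des ys y)
    (≈-trans (≈-sym (+-identityˡ _))
             (+-cong (≈-reflexive (sym (if-eta (does (y′ Finₚ.≟ y))))) ≈-refl))

  leafMatrix-no : ∀ b j {r x} → ¬ Designates j x r → ∀ y → leafMatrix b j r x y ≈ 0#
  leafMatrix-no true  j ¬des y = columnMatrix-no j ¬des (allFin d) y
  leafMatrix-no false j {r} ¬des y =
    ≈-trans (+-cong (≈-reflexive (unitMatrix-no j {y = zero} y ¬des)) ≈-refl) (+-identityˡ 0#)

  leafMatrix-one : ∀ {b} j {r x} → b ≡ false → Designates j x r → ∀ y → leafMatrix b j r x y ≈ 1#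
  leafMatrix-one j refl des zero =
    ≈-trans (+-cong (≈-reflexive (unitMatrix-yes j {k = 1} {y = zero} zero des)) ≈-refl) (+-identityʳ 1#)

  leafMatrix-cell : ∀ {b} j {r x} → b ≡ true → Designates j x r → ∀ {z y} → toℕ z ≡ toℕ y →
                    leafMatrix b j r x z ≈ cellAt j r y
  leafMatrix-cell j {r} refl des {z} z≡y with refl ← Finₚ.toℕ-injective z≡y =
    ≈-trans (columnMatrix-yes j des (allFin d) z)
    (≈-trans (∑-single 0# (cellAt j r) (allFin⁺ d) (∈-allFin z)) (+-identityʳ _))

  -- As Dⱼ has no repetitions, only one row of a leaf matrix can be nonzero.
  leafMatrix-nnz : ∀ b j r → nnz (leafMatrix b j r) ≤ width b
  leafMatrix-nnz b j r = ℕ.≤-trans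
    (length-filter-row (λ (x , y) → ¬? (leafMatrix b j r x y ≟ 0#))
      (λ {x} {y} {x′} {y′} nz nz′ →
        same (designates? j x r) (designates? j x′ r) nz nz′)
      (allFin⁺ (∣D∣ j)) (allFin (width b)))
    (ℕ.≤-reflexive (length-tabulate {n = width b} (λ y → y)))
    where
    same : ∀ {x y x′ y′} → Dec (Designates j x r) → Dec (Designates j x′ r) →
           ¬ leafMatrix b j r x y ≈ 0# → ¬ leafMatrix b j r x′ y′ ≈ 0# → x ≡ x′
    same (yes p) (yes p′) nz nz′ = designates-unique j p p′
    same (no ¬p) _        nz nz′ = contradiction (leafMatrix-no b j ¬p _) nz
    same _       (no ¬p)  nz nz′ = contradiction (leafMatrix-no b j ¬p _) nz′

  nnz-zero : ∀ {r k} → nnz {r} {k} (λ _ _ → 0#) ≡ 0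
  nnz-zero {r} {k} = cong length (filter-none (λ _ → ¬? (0# ≟ 0#))
    {List.cartesianProduct (allFin r) (allFin k)} (All.universal (λ _ 0≉0 → 0≉0 ≈-refl) _))

  SameRow : ∀ j → Fin (size j) → Fin (size j) → Set ℓ₁
  SameRow j r r′ = ∀ k → table j r k ≈ table j r′ k

  designates-cong : ∀ j {x r r′} → SameRow j r r′ → Designates j x r → Designates j x r′
  designates-cong j eq des (y , refl) = ≈-trans (des (y , refl)) (eq (proj₁ (assigned y)))

  cellAt-cong : ∀ j {r r′} → SameRow j r r′ → ∀ y → cellAt j r y ≈ cellAt j r′ y
  cellAt-cong j eq y with assign y Finₚ.≟ j
  ... | yes refl = eq _
  ... | no  _    = ≈-refl

  leafMatrix-cong : ∀ b j {r r′} → SameRow j r r′ → leafMatrix b j r ≈ᴹ leafMatrix b j r′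
  leafMatrix-cong b j {r} {r′} eq x y with designates? j x r
  ... | no ¬des = ≈-trans (leafMatrix-no b j ¬des y)
    (≈-sym (leafMatrix-no b j (¬des ∘ designates-cong j (≈-sym ∘ eq)) y))
  leafMatrix-cong true  j eq x y | yes des =
    ≈-trans (leafMatrix-cell j refl des refl)
    (≈-trans (cellAt-cong j eq y) (≈-sym (leafMatrix-cell j refl (designates-cong j eq des) refl)))
  leafMatrix-cong false j eq x y | yes des =
    ≈-trans (leafMatrix-one j refl des y) (≈-sym (leafMatrix-one j refl (designates-cong j eq des) y))

  -- A choice of one row of every table.
  Rows : Set
  Rows = ∀ i → Fin (size i)

  -- The j-th factor of a row of the i-th block.
  factorMatrix : ∀ i j → Fin (size j) → Matrix (∣D∣ j) (widths i j)
  factorMatrix i j = leafMatrix (does (j Finₚ.≟ i)) j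

  -- The Kronecker product of the factors.  If β are the rows that the x-th tuple
  -- projects to, this is the x-th row of the i-th block of J, the other rows being zero
  -- (blockRow-value).
  blockRow : Fin m → Rows → Matrix N d
  blockRow i β x y = ⨂ (λ j → factorMatrix i j (β j)) x (cast (d≡∏widths i) y)

  -- The i-th block of J: its columns assigned to table i.
  block : Fin m → Matrix N d
  block i x y = if does (i Finₚ.≟ assign y) then J x y else 0#

  -- a at the position (x₀ , y) if column y is assigned to table i, and zero elsewhere.
  select : Fin m → Fin N → Fin N → Fin d → Carrier → Carrier
  select i x₀ x y a = if does (x₀ Finₚ.≟ x) then (if does (i Finₚ.≟ assign y) then a else 0#) else 0#

  module _ {X : Vector Carrier d} {β : Rows} (β-rows : ∀ i k → table i (β i) k ≈ X (name i k)) where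

    proj-row : ∀ j (e : E j) → proj j (β j) e ≈ X (proj₁ e)
    proj-row j (y , refl) = ≈-trans (β-rows (assign y) _) (≈-reflexive (cong X (proj₂ (assigned y))))

    cellAt-row : ∀ i y → cellAt i (β i) y ≈ (if does (i Finₚ.≟ assign y) then X y else 0#)
    cellAt-row i y with assign y Finₚ.≟ i
    ... | yes refl = ≈-trans (proj-row i (y , refl))
                             (≈-reflexive (sym (if-yes (i Finₚ.≟ i) refl)))
    ... | no  y≢i  = ≈-reflexive (sym (if-no (i Finₚ.≟ assign y) (y≢i ∘ sym)))

  module _ {x₀ : Fin N} {β : Rows} (β-rows : ∀ i k → table i (β i) k ≈ tuple x₀ (name i k)) where

    designates-digit : ∀ j → Designates j (digits ∣D∣ x₀ j) (β j)
    designates-digit j (y , refl) = ≈-sym (proj-row {tuple x₀} {β} β-rows j (y , refl))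

    blockRow-other : ∀ i x y → x₀ ≢ x → blockRow i β x y ≈ 0#
    blockRow-other i x y x₀≢x =
      let j , digit≢ = Finₚ.¬∀⟶∃¬ m _ (λ j → digits ∣D∣ x₀ j Finₚ.≟ digits ∣D∣ x j)
                         (x₀≢x ∘ digits-injective ∣D∣ x₀ x)
      in product-zero _ j (leafMatrix-no (does (j Finₚ.≟ i)) j
           (λ des → digit≢ (designates-unique j (designates-digit j) des)) _)

    blockRow-same : ∀ i y → blockRow i β x₀ y ≈ (if does (i Finₚ.≟ assign y) then tuple x₀ y else 0#)
    blockRow-same i y =
      ≈-trans (product-single _ i λ j j≢i →
        leafMatrix-one j (dec-false (j Finₚ.≟ i) j≢i) (designates-digit j) _)
      (≈-trans (leafMatrix-cell i (dec-true (i Finₚ.≟ i) refl) (designates-digit i)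
        (trans (digits-single (widths i) i (widths-1 i) _) (Finₚ.toℕ-cast (d≡∏widths i) y)))
      (cellAt-row {tuple x₀} {β} β-rows i y))

    blockRow-value : ∀ i x y → blockRow i β x y ≈ select i x₀ x y (tuple x₀ y)
    blockRow-value i x y with x₀ Finₚ.≟ x
    ... | yes refl = blockRow-same i y
    ... | no  x₀≢x = blockRow-other i x y x₀≢x

  -- For each tuple of the join, rows of the tables that it projects to.
  witnesses : List (Fin N) → List Rows
  witnesses []       = []
  witnesses (x ∷ xs) with inJoin? (tuple x)
  ... | yes ∈join = (proj₁ ∘ ∈join) ∷ witnesses xs
  ... | no  _     = witnesses xs

  joinRows : List Rows
  joinRows = witnesses (allFin N)

  -- B plus the sum of the matrices blockRow i β.  The order of summation is
  -- the one in which sketches are added.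
  addBlockRows : Fin m → Matrix N d → List Rows → Matrix N d
  addBlockRows i B = List.foldr (λ β → blockRow i β +ᴹ_) B

  addBlockRows-witnesses : ∀ i B x y xs → addBlockRows i B (witnesses xs) x y ≈
    ∑ (B x y) (λ x₀ → select i x₀ x y (J x₀ y)) xs
  addBlockRows-witnesses i B x y []        = ≈-refl
  addBlockRows-witnesses i B x y (x₀ ∷ xs) with inJoin? (tuple x₀)
  ... | yes ∈join = +-cong
    (≈-trans (blockRow-value {x₀} (λ j → proj₂ (∈join j)) i x y)
             (≈-reflexive (cong (select i x₀ x y) (sym (if-yes (inJoin? (tuple x₀)) ∈join)))))
    (addBlockRows-witnesses i B x y xs)
  ... | no ∉join =
    ≈-trans (addBlockRows-witnesses i B x y xs)
    (≈-trans (≈-sym (+-identityˡ _))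
             (+-cong (≈-reflexive (sym (trans (cong (select i x₀ x y) (if-no (inJoin? (tuple x₀)) ∉join))
                                        (trans (cong (if does (x₀ Finₚ.≟ x) then_else 0#)
                                                     (if-eta (does (i Finₚ.≟ assign y))))
                                               (if-eta (does (x₀ Finₚ.≟ x))))))) ≈-refl))

  addBlockRows-join : ∀ i B → addBlockRows i B joinRows ≈ᴹ (block i +ᴹ B)
  addBlockRows-join i B x y =
    ≈-trans (addBlockRows-witnesses i B x y (allFin N))
            (∑-single (B x y) (λ x₀ → if does (i Finₚ.≟ assign y) then J x₀ y else 0#)
                      (allFin⁺ N) (∈-allFin x))

  -- B plus the blocks of J with indices in the list.
  addBlocks : Matrix N d → List (Fin m) → Matrix N d
  addBlocks B = List.foldr (λ i B → addBlockRows i B joinRows) B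

  addBlocks-∑ : ∀ B x y is → addBlocks B is x y ≈
                ∑ (B x y) (λ i → if does (i Finₚ.≟ assign y) then J x y else 0#) is
  addBlocks-∑ B x y []       = ≈-refl
  addBlocks-∑ B x y (i ∷ is) =
    ≈-trans (addBlockRows-join i (addBlocks B is) x y) (+-cong ≈-refl (addBlocks-∑ B x y is))

  J-blocks : addBlocks (λ _ _ → 0#) (allFin m) ≈ᴹ J
  J-blocks x y = ≈-trans (addBlocks-∑ (λ _ _ → 0#) x y (allFin m))
    (≈-trans (∑-single 0# (λ _ → J x y) (allFin⁺ m) (∈-allFin (assign y))) (+-identityʳ _))

-- Counting monomials, and the sketches of the blocks of J

-- The leftmost leaf.
someLeaf : ∀ {k} → MulTree k → Fin k
someLeaf leaf              = zero
someLeaf (_·_ {b = b} s _) = someLeaf s Fin.↑ˡ b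

module Counting {c ℓ₁ ℓ₂} {𝕊 : Scalars c ℓ₁ ℓ₂} {Q : Query} (I : Tables 𝕊 Q)
                (ρ : MulTree (Query.m Q)) where
  open Scalars 𝕊 using (Carrier; _≈_; _≟_)
    renaming (refl to ≈-refl; sym to ≈-sym; trans to ≈-trans)
  open Query Q
  open Tables I
  open Join I
  open LeafMatrices I

  -- Tables may contain equal rows, so choices of rows are compared by contents.
  rowsDecSetoid : DecSetoid 0ℓ ℓ₁
  rowsDecSetoid = record
    { Carrier = Rows
    ; _≈_     = λ α β → ∀ i → SameRow i (α i) (β i)
    ; isDecEquivalence = record
      { isEquivalence = record
        { refl  = λ i k → ≈-refl
        ; sym   = λ eq i k → ≈-sym (eq i k)
        ; trans = λ eq eq′ i k → ≈-trans (eq i k) (eq′ i k)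
        }
      ; _≟_ = λ α β → all? λ i → all? λ k → table i (α i) k ≟ table i (β i) k
      }
    }

  open DecSetoid rowsDecSetoid using () renaming (_≈_ to _∼_; _≟_ to _∼?_)
  open Multiplicities rowsDecSetoid

  -- Functions from choices of rows to natural numbers, with pointwise operations.
  countingSemiring : CommutativeSemiring 0ℓ 0ℓ
  countingSemiring = Pointwise.commutativeSemiring Rows ℕ.+-*-commutativeSemiring

  private module S = CommutativeSemiring countingSemiring

  sameRow? : ∀ i (u v : Vector Carrier (arity i)) → Dec (∀ k → u k ≈ v k)
  sameRow? i u v = all? λ k → u k ≟ v k

  -- The weight of the vector u for table i is the indicator function of the choices whose
  -- i-th row is u.
  indicators : Weights countingSemiring
  indicators i u α = ind (sameRow? i u (table i (α i)))

  indicators-cong : Congruent countingSemiring indicators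
  indicators-cong i {u} {v} u≈v α = ind-cong
    (λ eq k → ≈-trans (≈-sym (u≈v k)) (eq k)) (λ eq k → ≈-trans (u≈v k) (eq k))
    (sameRow? i u (table i (α i))) (sameRow? i v (table i (α i)))

  foldr-at : ∀ {n} (f : Vector S.Carrier n) α →
             Vector.foldr S._*_ S.1# f α ≡ Vector.foldr _*_ 1 (λ i → f i α)
  foldr-at {zero}  f α = refl
  foldr-at {suc n} f α = cong (f zero α *_) (foldr-at (f ∘ suc) α)

  -- The term of the FAQ for the tuple X: the indicator function of the choices that
  -- project from X.
  faqWeight : Vector Carrier d → S.Carrier
  faqWeight X = Vector.foldr S._*_ S.1# (λ i → indicators i (X ∘ name i))

  faqWeight≡ind : ∀ {X β} → (∀ i k → table i (β i) k ≈ X (name i k)) →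
                  ∀ α → faqWeight X α ≡ ind (β ∼? α)
  faqWeight≡ind {X} {β} β-rows α = begin
    faqWeight X α
      ≡⟨ foldr-at (λ i → indicators i (X ∘ name i)) α ⟩
    Vector.foldr _*_ 1 (λ i → ind (sameRow? i (X ∘ name i) (table i (α i))))
      ≡⟨ foldr-ind (λ i → sameRow? i (X ∘ name i) (table i (α i))) ⟩
    ind (all? λ i → sameRow? i (X ∘ name i) (table i (α i)))
      ≡⟨ ind-cong (λ eq i k → ≈-trans (β-rows i k) (eq i k))
                  (λ eq i k → ≈-trans (≈-sym (β-rows i k)) (eq i k))
                  (all? λ i → sameRow? i (X ∘ name i) (table i (α i))) (β ∼? α) ⟩
    ind (β ∼? α)
      ∎
    where open ≡-Reasoning

  -- Evaluated at α, the FAQ counts the tuples of the join with the projections α.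
  faq≡count : ∀ α → faq countingSemiring indicators α ≡ count α joinRows
  faq≡count α = begin
    total (List.tabulate tuple)       ≡⟨ cong total (sym (map-tabulate (λ x → x) tuple)) ⟩
    total (List.map tuple (allFin N)) ≡⟨ total-witnesses (allFin N) ⟩
    count α joinRows                  ∎
    where
    open ≡-Reasoning
    sum : List (Vector Carrier d) → ℕ
    sum Xs = List.foldr S._+_ S.0# (List.map faqWeight Xs) α
    total : List (Vector Carrier d) → ℕ
    total = sum ∘ filter inJoin?
    total-witnesses : ∀ xs → total (List.map tuple xs) ≡ count α (witnesses xs)
    total-witnesses []       = refl
    total-witnesses (x ∷ xs) with inJoin? (tuple x)
    ... | yes ∈join = trans (cong sum (filter-accept inJoin? ∈join))
      (cong₂ _+_ (faqWeight≡ind {tuple x} (λ i → proj₂ (∈join i)) α) (total-witnesses xs))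
    ... | no  ∉join = trans (cong sum (filter-reject inJoin? ∉join)) (total-witnesses xs)

  RowTerm : Node ρ → Set
  RowTerm = Term ρ (Fin ∘ size)

  monomials : RowTerm root → List Rows
  monomials T = List.map (assignment ρ) (leaves (expand T))

  ⟦_⟧S : ∀ {v} → RowTerm v → S.Carrier
  ⟦ T ⟧S = ⟦_⟧ᵀ S._+_ S._*_ T (λ i r → indicators i (table i r))

  ⟦⟧S-at : ∀ {v} (T : RowTerm v) α →
           ⟦ T ⟧S α ≡ ⟦_⟧ᵀ _+_ _*_ T (λ i r → indicators i (table i r) α)
  ⟦⟧S-at (gen i r)     α = refl
  ⟦⟧S-at (plus T U)    α = cong₂ _+_ (⟦⟧S-at T α) (⟦⟧S-at U α)
  ⟦⟧S-at (times _ T U) α = cong₂ _*_ (⟦⟧S-at T α) (⟦⟧S-at U α)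

  -- Evaluated at α, an expression counts its monomials with the rows α.
  ⟦⟧S≡count : ∀ T α → ⟦ T ⟧S α ≡ count α (monomials T)
  ⟦⟧S≡count T α = begin
    ⟦ T ⟧S α
      ≡⟨ ⟦⟧S-at T α ⟩
    ⟦_⟧ᵀ _+_ _*_ T h
      ≡⟨ ℕ.+-identityʳ _ ⟨
    ⟦_⟧ᵀ _+_ _*_ T h + 0
      ≡⟨ Sums.monomials-sum ℕ.+-isCommutativeSemigroup (cong₂ _*_) ℕ.*-distrib-+ h 0 T ⟩
    ∑ 0 (λ β → evalTree ρ _*_ (λ i → h i (β i))) (monomials T)
      ≡⟨ ∑-cong (λ β → evalTree-ind ρ (λ i → sameRow? i (table i (β i)) (table i (α i)))) (monomials T) ⟩
    count α (monomials T)
      ∎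
    where
    open ≡-Reasoning
    open Sums ℕ.+-isCommutativeSemigroup
    h : ∀ i → Fin (size i) → ℕ
    h i r = indicators i (table i r) α

  module _ {r ℓ} (Sk : DBSketch 𝕊 d ∣D∣ ρ r ℓ) where
    open Matrices 𝕊
    private module Sk = DBSketch Sk
    open Sk using (F; Fᵢ; _⊕_; _⊙_)
    open Setoid Sk.R_F using ()
      renaming (_≈_ to _≈ᴿ_; refl to R-refl; sym to R-sym; trans to R-trans)
    open IsCommutativeSemigroup Sk.⊕-isCommutativeSemigroup using () renaming (∙-cong to ⊕-cong)
    open Sums Sk.⊕-isCommutativeSemigroup

    -- The weights of the i-th run.
    leafSketch : ∀ i j → Fin (size j) → Sk.Carrier
    leafSketch i j r = Fᵢ j (factorMatrix i j r)

    rowSketch : Fin m → Rows → Sk.Carrier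
    rowSketch i β = evalTree ρ _⊙_ (λ j → leafSketch i j (β j))

    rowSketch≈F : ∀ i β → rowSketch i β ≈ᴿ F (blockRow i β)
    rowSketch≈F i β = R-sym (Sk.F-⨂ (d≡∏widths i) (λ j → factorMatrix i j (β j)))

    rowSketch-cong : ∀ i {α β} → α ∼ β → rowSketch i α ≈ᴿ rowSketch i β
    rowSketch-cong i α∼β = evalTree-cong _≈ᴿ_ Sk.⊙-cong ρ λ j →
      Sk.Fᵢ-cong j (leafMatrix-cong (does (j Finₚ.≟ i)) j (α∼β j))

    addBlockRows-sketch : ∀ i {B z} → z ≈ᴿ F B → ∀ βs →
                          ∑ z (rowSketch i) βs ≈ᴿ F (addBlockRows i B βs)
    addBlockRows-sketch i z≈ []       = z≈
    addBlockRows-sketch i z≈ (β ∷ βs) =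
      R-trans (⊕-cong (rowSketch≈F i β) (addBlockRows-sketch i z≈ βs)) (R-sym (Sk.F-+ _ _))

    sketchOf : Fin m → RowTerm root → Sk.Carrier
    sketchOf i T = ⟦_⟧ᵀ _⊕_ _⊙_ T (leafSketch i)

    -- If T evaluates to the FAQ in the counting semiring, its monomials are the tuples
    -- of the join, so that among sketches it evaluates to that of the i-th block.
    term-sketch : ∀ i {B z} → z ≈ᴿ F B → ∀ T → ⟦ T ⟧S S.≈ faq countingSemiring indicators →
                  (sketchOf i T ⊕ z) ≈ᴿ F (addBlockRows i B joinRows)
    term-sketch i {B} {z} z≈ T T≈faq =
      R-trans (monomials-sum Sk.⊙-cong Sk.distrib (leafSketch i) z T)
      (R-trans (equal-counts⇒equal-sums Sk.⊕-isCommutativeSemigroup (rowSketch-cong i) z (monomials T) joinRows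
                 λ α → trans (sym (⟦⟧S≡count T α)) (trans (T≈faq α) (faq≡count α)))
               (addBlockRows-sketch i z≈ joinRows))

    -- If the FAQ in the counting semiring vanishes, the join is empty.
    empty-sketch : ∀ i {B z} → z ≈ᴿ F B → S.0# S.≈ faq countingSemiring indicators →
                   z ≈ᴿ F (addBlockRows i B joinRows)
    empty-sketch i {B} {z} z≈ 0≈faq =
      R-trans (equal-counts⇒equal-sums Sk.⊕-isCommutativeSemigroup (rowSketch-cong i) z [] joinRows
                 λ α → trans (0≈faq α) (faq≡count α))
              (addBlockRows-sketch i z≈ joinRows)

    -- For any i, the numbers widths i j have the product d; the leftmost leaf is taken
    -- for i.
    zeroSketch : Sk.Carrier
    zeroSketch = evalTree ρ _⊙_ (λ j → Fᵢ j {widths (someLeaf ρ) j} (λ _ _ → Scalars.0# 𝕊))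

    zeroSketch≈F : zeroSketch ≈ᴿ F (λ _ _ → Scalars.0# 𝕊)
    zeroSketch≈F = R-trans
      (R-sym (Sk.F-⨂ (d≡∏widths (someLeaf ρ)) (λ j _ _ → Scalars.0# 𝕊)))
      (Sk.F-cong λ x y → Ring.product-zero 𝕊 (λ _ → Scalars.0# 𝕊) (someLeaf ρ) ≈-refl)

-- The time bound

length-cartesianProduct : ∀ {a b} {A : Set a} {B : Set b} (xs : List A) (ys : List B) →
                          length (cartesianProduct xs ys) ≡ length xs * length ys
length-cartesianProduct []       ys = refl
length-cartesianProduct (x ∷ xs) ys = trans (length-++ (List.map (x ,_) ys))
  (cong₂ _+_ (length-map (x ,_) ys) (length-cartesianProduct xs ys))

tree-positive : ∀ {k} → MulTree k → 1 ≤ k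
tree-positive leaf          = ℕ.≤-refl
tree-positive (_·_ {a} s t) = ℕ.≤-trans (tree-positive s) (ℕ.m≤m+n a _)

module _ (m T⊙ T⊕ T : ℕ) (1≤m : 1 ≤ m) (1≤T⊕ : 1 ≤ T⊕) (1≤T : 1 ≤ T) where
  open ℕ.≤-Reasoning

  private
    X = m * (T⊙ + T⊕) * T

    m*s≤X : m * (T⊙ + T⊕) ≤ X
    m*s≤X = ℕ.≤-trans (ℕ.≤-reflexive (sym (ℕ.*-identityʳ _))) (ℕ.*-monoʳ-≤ (m * (T⊙ + T⊕)) 1≤T)

    m≤X : m ≤ X
    m≤X = ℕ.≤-trans (ℕ.≤-reflexive (sym (ℕ.*-identityʳ m)))
         (ℕ.≤-trans (ℕ.*-monoʳ-≤ m (ℕ.≤-trans 1≤T⊕ (ℕ.m≤n+m T⊕ T⊙))) m*s≤X)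

    1≤X : 1 ≤ X
    1≤X = ℕ.≤-trans 1≤m m≤X

  small-bound : m * (T⊙ + 5) + 1 ≤ 38 * X
  small-bound = begin
    m * (T⊙ + 5) + 1            ≡⟨ solve 2 (λ m T⊙ → m ⊛ (T⊙ ⊹ con 5) ⊹ con 1 := m ⊛ T⊙ ⊹ con 5 ⊛ m ⊹ con 1)
                                     refl m T⊙ ⟩
    m * T⊙ + 5 * m + 1          ≤⟨ ℕ.+-mono-≤ (ℕ.+-mono-≤ (ℕ.≤-trans (ℕ.*-monoʳ-≤ m (ℕ.m≤m+n T⊙ T⊕)) m*s≤X)
                                                           (ℕ.*-monoʳ-≤ 5 m≤X)) 1≤X ⟩
    X + 5 * X + X               ≡⟨ solve 1 (λ X → X ⊹ con 5 ⊛ X ⊹ X := con 7 ⊛ X) refl X ⟩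
    7 * X                       ≤⟨ ℕ.*-monoˡ-≤ X (ℕ.m≤m+n 7 31) ⟩
    38 * X                      ∎

  module _ (T_f n d : ℕ) (1≤T_f : 1 ≤ T_f) (1≤d : 1 ≤ d) where
    private
      Y = T_f * m * n * d

      m*n*d≤Y : m * n * d ≤ Y
      m*n*d≤Y = ℕ.*-monoˡ-≤ d (ℕ.*-monoˡ-≤ n
        (ℕ.≤-trans (ℕ.≤-reflexive (sym (ℕ.*-identityˡ m))) (ℕ.*-monoˡ-≤ m 1≤T_f)))

      m*n≤Y : m * n ≤ Y
      m*n≤Y = ℕ.≤-trans (ℕ.≤-trans (ℕ.≤-reflexive (sym (ℕ.*-identityʳ _))) (ℕ.*-monoʳ-≤ (m * n) 1≤d)) m*n*d≤Y

    time-bound : m * (T⊙ + 5) + (1 + (2 * m) * (7 + n * (13 + T_f * d + d * 5))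
                   + (1 + m * ((T⊙ + T⊕) * T + (T⊕ + 5)))) ≤ 38 * (X + Y)
    time-bound = begin
      m * (T⊙ + 5) + (1 + (2 * m) * (7 + n * (13 + T_f * d + d * 5))
        + (1 + m * ((T⊙ + T⊕) * T + (T⊕ + 5))))
        ≡⟨ solve 7 (λ m T⊙ T⊕ T T_f n d →
             m ⊛ (T⊙ ⊹ con 5) ⊹ (con 1 ⊹ (con 2 ⊛ m) ⊛ (con 7 ⊹ n ⊛ (con 13 ⊹ T_f ⊛ d ⊹ d ⊛ con 5))
               ⊹ (con 1 ⊹ m ⊛ ((T⊙ ⊹ T⊕) ⊛ T ⊹ (T⊕ ⊹ con 5))))
             := m ⊛ (T⊙ ⊹ T⊕) ⊛ T ⊹ m ⊛ (T⊙ ⊹ T⊕) ⊹ con 24 ⊛ m ⊹ con 2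
                ⊹ (con 26 ⊛ (m ⊛ n) ⊹ con 2 ⊛ (T_f ⊛ m ⊛ n ⊛ d) ⊹ con 10 ⊛ (m ⊛ n ⊛ d)))
             refl m T⊙ T⊕ T T_f n d ⟩
      X + m * (T⊙ + T⊕) + 24 * m + 2 * 1 + (26 * (m * n) + 2 * Y + 10 * (m * n * d))
        ≤⟨ ℕ.+-mono-≤
             (ℕ.+-mono-≤ (ℕ.+-mono-≤ (ℕ.+-monoʳ-≤ X m*s≤X) (ℕ.*-monoʳ-≤ 24 m≤X)) (ℕ.*-monoʳ-≤ 2 1≤X))
             (ℕ.+-mono-≤ (ℕ.+-monoˡ-≤ (2 * Y) (ℕ.*-monoʳ-≤ 26 m*n≤Y)) (ℕ.*-monoʳ-≤ 10 m*n*d≤Y)) ⟩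
      X + X + 24 * X + 2 * X + (26 * Y + 2 * Y + 10 * Y)
        ≡⟨ solve 2 (λ X Y → X ⊹ X ⊹ con 24 ⊛ X ⊹ con 2 ⊛ X ⊹ (con 26 ⊛ Y ⊹ con 2 ⊛ Y ⊹ con 10 ⊛ Y)
                            := con 28 ⊛ X ⊹ con 38 ⊛ Y) refl X Y ⟩
      28 * X + 38 * Y
        ≤⟨ ℕ.+-monoˡ-≤ (38 * Y) (ℕ.*-monoˡ-≤ X (ℕ.m≤m+n 28 10)) ⟩
      38 * X + 38 * Y
        ≡⟨ ℕ.*-distribˡ-+ 38 X Y ⟨
      38 * (X + Y) ∎

-- The program

module SketchProgram (Q : Query) (ρ : MulTree (Query.m Q)) (program : Cmd Q (Factor Q)) where
  open Query Q
  open LeafEntries Q public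
  open Addressing (2 + m) public

  -- Tag 0 belongs to the accumulated sketch and the counter, tags 1 and 2 to the leaf
  -- sketches, and tag 3 + i to the i-th run.  Disjoint tags keep the runs from
  -- reading what others have left behind.
  leafTag : Bool → Tag
  leafTag false = suc zero
  leafTag true  = suc (suc zero)

  runTag : Fin m → Tag
  runTag i = suc (suc (suc i))

  -- The sketches of the leaf matrices of table j, indexed by rows.
  leafArray : Bool → Fin m → ℕ
  leafArray b j = addr (leafTag b) (toℕ j)

  -- Cell c of array 0 is set to the product, in the order of the tree, of sketches of
  -- zero matrices; the cells above serve as a stack.
  zeros : ∀ {k} → MulTree k → (Fin k → Fin m) → ℕ → Cmd Q (Sketching Q)
  zeros leaf              ι c = produce 0 (lit c) (sketch (ι zero) (widths (someLeaf ρ) (ι zero)) [])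
  zeros (_·_ {a} {b} s t) ι c =
    zeros s (ι ∘ (_↑ˡ b)) c ⨾ zeros t (ι ∘ (a ↑ʳ_)) (suc c) ⨾ mul 0 (lit c) 0 (lit c) 0 (lit (suc c))

  counter : Exp Q
  counter = 0 [ lit 0 ]

  fillStep : Bool → Fin m → Cmd Q (Sketching Q)
  fillStep b j = produce (leafArray b j) counter (sketch j (width b) (leafEntries b j counter))
               ⨾ word 0 (lit 0) (counter :+ lit 1)

  fillLoop : Bool → Fin m → Cmd Q (Sketching Q)
  fillLoop b j = while (less counter (rowsOf j)) (fillStep b j)

  -- All leaf sketches with the given kinds and tables.
  fills : List (Bool × Fin m) → Cmd Q (Sketching Q)
  fills []             = skip
  fills ((b , j) ∷ ps) = fills ps ⨾ word 0 (lit 0) (lit 0) ⨾ fillLoop b j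

  run : Fin m → Cmd Q (Sketching Q)
  run i = Relocation.relocate {Q} (runTag i) (λ j → leafArray (does (j Finₚ.≟ i)) j) program

  -- Cell 0 of array 0 accumulates the outputs of the runs.
  accumulate : Fin m → Cmd Q (Sketching Q)
  accumulate i = branch (filled (addr (runTag i) 0) (lit 0))
                        (add 0 (lit 0) (addr (runTag i) 0) (lit 0) 0 (lit 0))
                        skip

  runs : List (Fin m) → Cmd Q (Sketching Q)
  runs []       = skip
  runs (i ∷ is) = runs is ⨾ run i ⨾ accumulate i

  allLeaves : List (Bool × Fin m)
  allLeaves = cartesianProduct (false ∷ true ∷ []) (allFin m)

  -- Without columns there is nothing to add.  This case is separated because the time
  -- bound then has no room for reading the tables.
  addAllBlocks : Dec (d ≡ 0) → Cmd Q (Sketching Q)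
  addAllBlocks (yes _) = skip
  addAllBlocks (no  _) = fills allLeaves ⨾ runs (allFin m)

  sketchProgram : Cmd Q (Sketching Q)
  sketchProgram = zeros ρ id 0 ⨾ addAllBlocks (d ℕ.≟ 0)

  leafTag≢runTag : ∀ b i → leafTag b ≢ runTag i
  leafTag≢runTag false i ()
  leafTag≢runTag true  i ()

  leafArray-injective : ∀ {b j b′ j′} → leafArray b j ≡ leafArray b′ j′ → (b , j) ≡ (b′ , j′)
  leafArray-injective {false} {j} {false} {j′} eq =
    cong (false ,_) (Finₚ.toℕ-injective (addr-injective (leafTag false) eq))
  leafArray-injective {true} {j} {true} {j′} eq =
    cong (true ,_) (Finₚ.toℕ-injective (addr-injective (leafTag true) eq))
  leafArray-injective {false} {j} {true} {j′} eq = contradiction eq (addr-otherTag (toℕ j) (toℕ j′) λ ())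
  leafArray-injective {true} {j} {false} {j′} eq = contradiction eq (addr-otherTag (toℕ j) (toℕ j′) λ ())

  leafArray≢0 : ∀ b j → leafArray b j ≢ 0
  leafArray≢0 false j ()
  leafArray≢0 true  j ()

-- Its execution

module _ {c ℓ₁ ℓ₂ s ℓ} {𝕊 : Scalars c ℓ₁ ℓ₂} {Q : Query} (I : Tables 𝕊 Q)
         (S : CommutativeSemiring s ℓ) (g : Join.Weights I S) where
  open Semantics I

  cost-test-positive : ∀ C → 1 ≤ cost-test C
  cost-test-positive (less _ _)          = s≤s z≤n
  cost-test-positive (cell< _ _ _ _ _ _) = s≤s z≤n
  cost-test-positive (filled _ _)        = s≤s z≤n

  run-positive : ∀ {p σ T σ′} → Run (faqValues S g) p σ T σ′ → 1 ≤ T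
  run-positive skip                         = s≤s z≤n
  run-positive word                         = s≤s z≤n
  run-positive (produce {l = factor _ _} _) = s≤s z≤n
  run-positive (copy _)                     = s≤s z≤n
  run-positive (add _ _)                    = s≤s z≤n
  run-positive (mul _ _)                    = s≤s z≤n
  run-positive (seq run _)                  = ℕ.≤-trans (run-positive run) (ℕ.m≤m+n _ _)
  run-positive (branch {c = C} _ _)         = ℕ.≤-trans (cost-test-positive C) (ℕ.m≤m+n _ _)
  run-positive (stop {c = C} _)             = cost-test-positive C
  run-positive (loop {c = C} _ _ _)         =
    ℕ.≤-trans (cost-test-positive C) (ℕ.≤-trans (ℕ.m≤m+n _ _) (ℕ.m≤m+n _ _))

module Execution
  {c ℓ₁ ℓ₂ r ℓ} {𝕊 : Scalars c ℓ₁ ℓ₂} {Q : Query} {ρ : MulTree (Query.m Q)}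
  (A : FAQAlgorithm 𝕊 Q ρ) (I : Tables 𝕊 Q) (Sk : DBSketch 𝕊 (Query.d Q) (Join.∣D∣ I) ρ r ℓ)
  (T⊕ T⊙ T_f : ℕ) .{{_ : NonZero T⊕}} .{{_ : NonZero T⊙}} .{{_ : NonZero T_f}}
  where
  open Query Q
  open Tables I
  open FAQAlgorithm A
  open Join I
  open Semantics I
  open Matrices 𝕊 using (Matrix; nnz)
  open LeafMatrices I using (leafMatrix; matrix-leafEntries; leafMatrix-nnz; leafEntries-cost; nnz-zero;
    addBlocks; addBlockRows; joinRows; J-blocks; entriesCost)
  open Counting I ρ
  open SketchProgram Q ρ program
  open DBSketch Sk using (F; Fᵢ; _⊕_; _⊙_; F-cong) renaming (Carrier to R; _≈_ to _≈ᴿ_)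
  open Setoid (DBSketch.R_F Sk) using () renaming (refl to R-refl; sym to R-sym; trans to R-trans)
  private
    module S = CommutativeSemiring countingSemiring
    V = sketchValues Sk T⊕ T⊙ T_f
    0ᴹ : ∀ {r k} → Matrix r k
    0ᴹ _ _ = Scalars.0# 𝕊

  Cells : Set r
  Cells = Memory (Maybe R)

  zeroProduct : ∀ {k} → MulTree k → (Fin k → Fin m) → R
  zeroProduct t ι = evalTree t _⊙_ (λ i → Fᵢ (ι i) {widths (someLeaf ρ) (ι i)} 0ᴹ)

  -- The T⊙ + 3 on the left is the cost of one multiplication: there is one more leaf
  -- than there are multiplications, and the induction spends it at the parent node.
  run-zeros : ∀ {k} (t : MulTree k) ι c w s → ∃ λ T → ∃ λ s′ →
              Run V (zeros t ι c) (w , s) T (w , s′) ×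
              s′ 0 c ≡ just (zeroProduct t ι) ×
              (∀ {x l} → x ≢ 0 ⊎ l < c → s′ x l ≡ s x l) ×
              T + (T⊙ + 3) ≤ k * (T⊙ + 5)
  run-zeros leaf ι c w s = _ , _ , produce refl , update-same s 0 c _ , frame , cost
    where
    i = ι zero
    v = widths (someLeaf ρ) i
    frame : ∀ {x l} → x ≢ 0 ⊎ l < c → (s [ 0 , c ]≔ just (zeroProduct leaf ι)) x l ≡ s x l
    frame (inj₁ x≢0) = update-otherArray s 0 c _ (x≢0 ∘ sym) _
    frame (inj₂ l<c) = update-otherCell s 0 c _ _ (ℕ.<⇒≢ l<c ∘ sym)
    cost : 1 + T_f * nnz {∣D∣ i} {v} 0ᴹ + 0 + 1 + (T⊙ + 3) ≤ 1 * (T⊙ + 5)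
    cost rewrite nnz-zero {∣D∣ i} {v} | ℕ.*-zeroʳ T_f =
      ℕ.≤-reflexive (solve 1 (λ n → con 2 ⊹ (n ⊹ con 3) := con 1 ⊛ (n ⊹ con 5)) refl T⊙)
  run-zeros (_·_ {a} {b} t u) ι c w s =
    let T₁ , s₁ , run₁ , result₁ , frame₁ , cost₁ = run-zeros t (ι ∘ (_↑ˡ b)) c w s
        T₂ , s₂ , run₂ , result₂ , frame₂ , cost₂ = run-zeros u (ι ∘ (a ↑ʳ_)) (suc c) w s₁
        kept : s₂ 0 c ≡ just (zeroProduct t (ι ∘ (_↑ˡ b)))
        kept = trans (frame₂ (inj₂ (ℕ.n<1+n c))) result₁
    in _ , _ , seq run₁ (seq run₂ (mul kept result₂)) , update-same s₂ 0 c _ ,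
       (λ { (inj₁ x≢0) → trans (update-otherArray s₂ 0 c _ (x≢0 ∘ sym) _)
                         (trans (frame₂ (inj₁ x≢0)) (frame₁ (inj₁ x≢0)))
          ; (inj₂ l<c) → trans (update-otherCell s₂ 0 c _ _ (ℕ.<⇒≢ l<c ∘ sym))
                         (trans (frame₂ (inj₂ (ℕ.m<n⇒m<1+n l<c))) (frame₁ (inj₂ l<c))) }) ,
       ℕ.≤-trans (ℕ.≤-reflexive (regroup T₁ T₂ T⊙))
       (ℕ.≤-trans (ℕ.+-mono-≤ cost₁ cost₂) (ℕ.≤-reflexive (sym (ℕ.*-distribʳ-+ (T⊙ + 5) a b))))
    where
    regroup : ∀ T₁ T₂ n → T₁ + (T₂ + (n + 1 + 1 + 1)) + (n + 3) ≡ T₁ + (n + 3) + (T₂ + (n + 3))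
    regroup = solve 3 (λ T₁ T₂ n → T₁ ⊹ (T₂ ⊹ (n ⊹ con 1 ⊹ con 1 ⊹ con 1)) ⊹ (n ⊹ con 3)
                                   := T₁ ⊹ (n ⊹ con 3) ⊹ (T₂ ⊹ (n ⊹ con 3))) refl

  Filled : Cells → Bool → Fin m → Set r
  Filled s b j = ∀ r → s (leafArray b j) (toℕ r) ≡ just (Fᵢ j (leafMatrix b j r))

  -- A pass of the loop: 4 for the test, 3 and the sketching for the leaf sketch, 6 for
  -- incrementing the counter.  Listing an entry costs at most 5.
  fillStepCost : Bool → ℕ
  fillStepCost b = 13 + T_f * width b + width b * 5

  run-fillStep : ∀ b j {w s} r → w 0 0 ≡ toℕ r → ∃ λ T →
    Run V (fillStep b j) (w , s) T
      (w [ 0 , 0 ]≔ suc (toℕ r) , s [ leafArray b j , toℕ r ]≔ just (Fᵢ j (leafMatrix b j r))) ×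
    4 + T ≤ fillStepCost b
  run-fillStep b j {w} {s} r at-r = T₁ + 6 ,
    subst (λ k → Run V (fillStep b j) (w , s) (T₁ + 6) (w [ 0 , 0 ]≔ k , s₁))
          (trans (cong (_+ 1) at-r) (ℕ.+-comm (toℕ r) 1)) (seq produced word) ,
    cost
    where
    es = leafEntries b j counter
    M = leafMatrix b j r
    s₁ = s [ leafArray b j , toℕ r ]≔ just (Fᵢ j M)
    T₁ = 1 + T_f * Maybe.maybe nnz 0 (matrix w j es) + entriesCost es + 2
    found : matrix w j es ≡ just M
    found = matrix-leafEntries {w} {j} {counter} {r} at-r b
    produced : Run V (produce (leafArray b j) counter (sketch j (width b) es)) (w , s) T₁ (w , s₁)
    produced = subst (λ k → Run V (produce (leafArray b j) counter (sketch j (width b) es))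
                                (w , s) T₁ (w , s [ leafArray b j , k ]≔ just (Fᵢ j M)))
                     at-r (produce (cong (Maybe.map (Fᵢ j)) found))
    open ℕ.≤-Reasoning
    cost : 4 + (T₁ + 6) ≤ fillStepCost b
    cost = begin
      4 + (T₁ + 6)
        ≡⟨ cong (λ B → 4 + ((1 + T_f * Maybe.maybe nnz 0 B + entriesCost es + 2) + 6)) found ⟩
      4 + ((1 + T_f * nnz M + entriesCost es + 2) + 6)
        ≡⟨ solve 2 (λ a b → con 4 ⊹ ((con 1 ⊹ a ⊹ b ⊹ con 2) ⊹ con 6) := con 13 ⊹ a ⊹ b) refl
                 (T_f * nnz M) (entriesCost es) ⟩
      13 + T_f * nnz M + entriesCost es
        ≤⟨ ℕ.+-mono-≤ (ℕ.+-monoʳ-≤ 13 (ℕ.*-monoʳ-≤ T_f (leafMatrix-nnz b j r)))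
                      (leafEntries-cost b j counter) ⟩
      fillStepCost b ∎

  -- k rows have been treated, and n remain.
  run-fillLoop : ∀ b j n k {w s} → w 0 0 ≡ k → k + n ≡ size j → ∃ λ T → ∃ λ w′ → ∃ λ s′ →
    Run V (fillLoop b j) (w , s) T (w′ , s′) ×
    (∀ r → k ≤ toℕ r → s′ (leafArray b j) (toℕ r) ≡ just (Fᵢ j (leafMatrix b j r))) ×
    (∀ l → l < k → s′ (leafArray b j) l ≡ s (leafArray b j) l) ×
    (∀ {y} → y ≢ leafArray b j → ∀ l → s′ y l ≡ s y l) ×
    (∀ {y} → y ≢ 0 → ∀ l → w′ y l ≡ w y l) ×
    T ≤ 4 + n * fillStepCost b
  run-fillLoop b j zero k {w} {s} at-k k+0 = _ , _ , _ ,
    stop (cong just (dec-false (w 0 0 ℕ.<? size j)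
           (λ lt → ℕ.<-irrefl (trans at-k (trans (sym (ℕ.+-identityʳ k)) k+0)) lt))) ,
    (λ r k≤r → contradiction (ℕ.≤-trans (ℕ.≤-reflexive (trans (sym k+0) (ℕ.+-identityʳ k))) k≤r)
                             (ℕ.<⇒≱ (Finₚ.toℕ<n r))) ,
    (λ _ _ → refl) , (λ _ _ → refl) , (λ _ _ → refl) , ℕ.≤-refl
  run-fillLoop b j (suc n) k {w} {s} at-k k+n =
    let k<size = ℕ.≤-trans (ℕ.m<m+n k (s≤s z≤n)) (ℕ.≤-reflexive k+n)
        r₀ = fromℕ< k<size
        r₀≡k = Finₚ.toℕ-fromℕ< k<size
        T₁ , step , cost₁ = run-fillStep b j {w} {s} r₀ (trans at-k (sym r₀≡k))
        a = leafArray b j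
        w₁ = w [ 0 , 0 ]≔ suc (toℕ r₀)
        v₁ = just (Fᵢ j (leafMatrix b j r₀))
        s₁ = s [ a , toℕ r₀ ]≔ v₁
        T₂ , w₂ , s₂ , rest , new , old , cells , words , cost₂ =
          run-fillLoop b j n (suc k) {w₁} {s₁}
            (trans (update-same w 0 0 (suc (toℕ r₀))) (cong suc r₀≡k)) (trans (sym (ℕ.+-suc k n)) k+n)
    in _ , w₂ , s₂ ,
       loop (cong just (dec-true (w 0 0 ℕ.<? size j) (subst (_< size j) (sym at-k) k<size))) step rest ,
       (λ r k≤r → fills-from r r₀ r₀≡k s₂ (new r) (trans (old (toℕ r₀) (ℕ.≤-reflexive (cong suc r₀≡k)))
                                                (update-same s a (toℕ r₀) v₁)) (ℕ.m≤n⇒m<n∨m≡n k≤r)) ,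
       (λ l l<k → trans (old l (ℕ.m<n⇒m<1+n l<k))
                        (update-otherCell s a (toℕ r₀) v₁ a
                           (λ r₀≡l → ℕ.<⇒≢ l<k (trans (sym r₀≡l) r₀≡k)))) ,
       (λ y≢a l → trans (cells y≢a l) (update-otherArray s a (toℕ r₀) v₁ (y≢a ∘ sym) l)) ,
       (λ y≢0 l → trans (words y≢0 l) (update-otherArray w 0 0 (suc (toℕ r₀)) (y≢0 ∘ sym) l)) ,
       ℕ.≤-trans (ℕ.+-mono-≤ cost₁ cost₂)
                 (ℕ.≤-reflexive (trans (sym (ℕ.+-assoc (fillStepCost b) 4 _))
                                (trans (cong (_+ n * fillStepCost b) (ℕ.+-comm (fillStepCost b) 4))
                                       (ℕ.+-assoc 4 (fillStepCost b) _))))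
    where
    fills-from : ∀ r r₀ → toℕ r₀ ≡ k → ∀ s₂ →
             (suc k ≤ toℕ r → s₂ (leafArray b j) (toℕ r) ≡ just (Fᵢ j (leafMatrix b j r))) →
             s₂ (leafArray b j) (toℕ r₀) ≡ just (Fᵢ j (leafMatrix b j r₀)) →
             k < toℕ r ⊎ k ≡ toℕ r → s₂ (leafArray b j) (toℕ r) ≡ just (Fᵢ j (leafMatrix b j r))
    fills-from r r₀ r₀≡k s₂ new at-r₀ (inj₁ k<r) = new k<r
    fills-from r r₀ r₀≡k s₂ new at-r₀ (inj₂ k≡r) with refl ← Finₚ.toℕ-injective (trans r₀≡k k≡r) = at-r₀

  size≤maxSize : ∀ j → size j ≤ maxSize
  size≤maxSize = entry≤max size
    where
    entry≤max : ∀ {n} (f : Fin n → ℕ) j → f j ≤ Vector.foldr ℕ._⊔_ 0 f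
    entry≤max f zero    = ℕ.m≤m⊔n _ _
    entry≤max f (suc j) = ℕ.≤-trans (entry≤max (f ∘ suc) j) (ℕ.m≤n⊔m _ _)

  -- A bound for the time of filling one array of leaf sketches.
  leafCost : ℕ
  leafCost = 7 + maxSize * (13 + T_f * d + d * 5)

  module _ (0<d : 0 < d) where

    fillStepCost-bound : ∀ b → fillStepCost b ≤ 13 + T_f * d + d * 5
    fillStepCost-bound b =
      ℕ.+-mono-≤ (ℕ.+-monoʳ-≤ 13 (ℕ.*-monoʳ-≤ T_f (width≤d b))) (ℕ.*-monoˡ-≤ 5 (width≤d b))
      where
      width≤d : ∀ b → width b ≤ d
      width≤d true  = ℕ.≤-refl
      width≤d false = 0<d

    run-fills : ∀ ps w s → ∃ λ T → ∃ λ w′ → ∃ λ s′ →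
      Run V (fills ps) (w , s) T (w′ , s′) ×
      (∀ b j → (b , j) ∈ ps → Filled s′ b j) ×
      (∀ {y} → (∀ b j → y ≢ leafArray b j) → ∀ l → s′ y l ≡ s y l) ×
      (∀ {y} → y ≢ 0 → ∀ l → w′ y l ≡ w y l) ×
      T ≤ 1 + length ps * leafCost
    run-fills [] w s = _ , _ , _ , skip , (λ _ _ ()) , (λ _ _ → refl) , (λ _ _ → refl) , ℕ.≤-refl
    run-fills ((b , j) ∷ ps) w s =
      let T₁ , w₁ , s₁ , run₁ , filled₁ , cells₁ , words₁ , cost₁ = run-fills ps w s
          w₂ = w₁ [ 0 , 0 ]≔ 0
          T₂ , w₃ , s₃ , run₂ , filled₂ , _ , cells₂ , words₂ , cost₂ =
            run-fillLoop b j (size j) 0 {w₂} {s₁} (update-same w₁ 0 0 0) refl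
      in _ , w₃ , s₃ , seq run₁ (seq word run₂) ,
         (λ b′ j′ → all-filled s₁ s₃ filled₁ (λ r → filled₂ r z≤n) cells₂ b′ j′
                      (≡-dec Bool._≟_ Finₚ._≟_ (b′ , j′) (b , j))) ,
         (λ y≢ l → trans (cells₂ (y≢ b j) l) (cells₁ y≢ l)) ,
         (λ y≢0 l → trans (words₂ y≢0 l) (trans (update-otherArray w₁ 0 0 0 (y≢0 ∘ sym) l) (words₁ y≢0 l))) ,
         total cost₁ (ℕ.+-monoʳ-≤ 3 (ℕ.≤-trans cost₂
           (ℕ.+-monoʳ-≤ 4 (ℕ.*-mono-≤ (size≤maxSize j) (fillStepCost-bound b)))))
      where
      all-filled : ∀ s₁ s₃ → (∀ b j → (b , j) ∈ ps → Filled s₁ b j) → Filled s₃ b j →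
                   (∀ {y} → y ≢ leafArray b j → ∀ l → s₃ y l ≡ s₁ y l) →
                   ∀ b′ j′ → Dec ((b′ , j′) ≡ (b , j)) → (b′ , j′) ∈ (b , j) ∷ ps → Filled s₃ b′ j′
      all-filled s₁ s₃ filled₁ filled₃ cells b′ j′ (yes refl) _ = filled₃
      all-filled s₁ s₃ filled₁ filled₃ cells b′ j′ (no ≢) (here eq) = contradiction eq ≢
      all-filled s₁ s₃ filled₁ filled₃ cells b′ j′ (no ≢) (there ∈ps) r =
        trans (cells (≢ ∘ leafArray-injective) (toℕ r)) (filled₁ b′ j′ ∈ps r)
      total : ∀ {T₁ T₂} → T₁ ≤ 1 + length ps * leafCost → T₂ ≤ leafCost →
              T₁ + T₂ ≤ 1 + (leafCost + length ps * leafCost)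
      total {T₁} {T₂} p q = ℕ.≤-trans (ℕ.+-mono-≤ p q)
        (ℕ.≤-reflexive (cong suc (ℕ.+-comm (length ps * leafCost) leafCost)))

  -- A bound for the time of one run and of the addition of its output.
  runCost : ℕ
  runCost = (T⊙ + T⊕) * T-FAQ I + (T⊕ + 5)

  -- The arrays of the i-th run are in their initial state.
  Fresh : Fin m → State V → Set r
  Fresh i (w , s) = ∀ x l → w (addr (runTag i) x) l ≡ 0 × s (addr (runTag i) x) l ≡ nothing

  zero-untagged : ∀ i → ¬ Tagged (runTag i) 0
  zero-untagged i eq = contradiction (tag-unique {zero} {runTag i} 0 refl eq) λ ()

  -- The i-th run adds the i-th block.
  run-run : ∀ i {B z w s} → Fresh i (w , s) → (∀ b j → Filled s b j) → s 0 0 ≡ just z → z ≈ᴿ F B →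
    ∃ λ T → ∃ λ w′ → ∃ λ s′ → ∃ λ z′ →
    Run V (run i ⨾ accumulate i) (w , s) T (w′ , s′) ×
    s′ 0 0 ≡ just z′ × z′ ≈ᴿ F (addBlockRows i B joinRows) ×
    (∀ {y} → ¬ Tagged (runTag i) y → ∀ l → w′ y l ≡ w y l) ×
    (∀ {y} → y ≢ 0 → ¬ Tagged (runTag i) y → ∀ l → s′ y l ≡ s y l) ×
    T ≤ runCost
  run-run i {B} {z} {w} {s} fresh all-filled at-0 z≈ =
    let σF , runF , correct = evaluates I countingSemiring indicators indicators-cong
        T₁ , (w₁ , s₁) , run₁ , sim , cost₁ =
          simulate (w , s) source-untagged (λ j r → all-filled (does (j Finₚ.≟ i)) j r) follows runF start
        T₂ , s₂ , z₂ , run₂ , at-0₂ , z₂≈ , cells₂ , cost₂ =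
          finish w₁ s₁ (proj₂ σF 0 0) out-root (cells sim 0 0)
            (trans (cells-frame sim (zero-untagged i) 0) at-0) correct refl
    in _ , w₁ , s₂ , z₂ , seq run₁ run₂ , at-0₂ , z₂≈ , words-frame sim ,
       (λ y≢0 ¬tag l → trans (cells₂ y≢0 l) (cells-frame sim ¬tag l)) ,
       ℕ.+-mono-≤ cost₁ cost₂
    where
    t = runTag i
    open Simulation I Sk T⊕ T⊙ T_f countingSemiring indicators nodeOf t
           (λ j → leafArray (does (j Finₚ.≟ i)) j) (leafSketch Sk i)
    open Simulates

    source-untagged : ∀ j → ¬ Tagged t (leafArray (does (j Finₚ.≟ i)) j)
    source-untagged j tagged = leafTag≢runTag kind i
      (tag-unique (leafArray kind j) (addr-tagged (leafTag kind) (toℕ j)) tagged)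
      where kind = does (j Finₚ.≟ i)

    start : Simulates (w , s) (initial (faqValues countingSemiring indicators)) (w , s)
    start = record
      { words       = λ x l → proj₁ (fresh x l)
      ; cells       = λ x l → subst (Related (nodeOf x) nothing) (sym (proj₂ (fresh x l))) empty
      ; words-frame = λ _ _ → refl
      ; cells-frame = λ _ _ → refl
      }

    finish : ∀ w s a {v b} → v ≡ root → Related v a b → s 0 0 ≡ just z →
             fromMaybe S.0# a S.≈ faq countingSemiring indicators → s (addr t 0) 0 ≡ b →
             ∃ λ T → ∃ λ s′ → ∃ λ z′ →
             Run V (accumulate i) (w , s) T (w , s′) ×
             s′ 0 0 ≡ just z′ × z′ ≈ᴿ F (addBlockRows i B joinRows) ×
             (∀ {y} → y ≢ 0 → ∀ l → s′ y l ≡ s y l) ×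
             T ≤ T⊕ + 5
    finish w s _ refl empty at-0 correct out = _ , s , z ,
      branch (cong (just ∘ Maybe.is-just) out) skip , at-0 , empty-sketch Sk i z≈ correct ,
      (λ _ _ → refl) , ℕ.≤-trans (ℕ.m≤m+n 3 2) (ℕ.m≤n+m 5 T⊕)
    finish w s _ refl (value T) at-0 correct out = _ , _ , _ ,
      branch (cong (just ∘ Maybe.is-just) out) (add out at-0) ,
      update-same s 0 0 _ , term-sketch Sk i z≈ T correct ,
      (λ y≢0 l → update-otherArray s 0 0 _ (y≢0 ∘ sym) l) ,
      ℕ.≤-reflexive (solve 1 (λ n → con 2 ⊹ (n ⊹ con 1 ⊹ con 1 ⊹ con 1) := n ⊹ con 5) refl T⊕)

  run-runs : ∀ is → Unique is → ∀ {B z w s} →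
    (∀ {i} → i ∈ is → Fresh i (w , s)) → (∀ b j → Filled s b j) → s 0 0 ≡ just z → z ≈ᴿ F B →
    ∃ λ T → ∃ λ w′ → ∃ λ s′ → ∃ λ z′ →
    Run V (runs is) (w , s) T (w′ , s′) ×
    s′ 0 0 ≡ just z′ × z′ ≈ᴿ F (addBlocks B is) ×
    (∀ {y} → (∀ {i} → i ∈ is → ¬ Tagged (runTag i) y) → ∀ l → w′ y l ≡ w y l) ×
    (∀ {y} → y ≢ 0 → (∀ {i} → i ∈ is → ¬ Tagged (runTag i) y) → ∀ l → s′ y l ≡ s y l) ×
    T ≤ 1 + length is * runCost
  run-runs [] _ fresh all-filled at-0 z≈ =
    _ , _ , _ , _ , skip , at-0 , z≈ , (λ _ _ → refl) , (λ _ _ _ → refl) , ℕ.≤-refl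
  run-runs (i ∷ is) (i∉is ∷ unique) {w = w} {s} fresh all-filled at-0 z≈ =
    let T₁ , w₁ , s₁ , z₁ , run₁ , at-0₁ , z₁≈ , words₁ , cells₁ , cost₁ =
          run-runs is unique {w = w} {s} (fresh ∘ there) all-filled at-0 z≈
        T₂ , w₂ , s₂ , z₂ , run₂ , at-0₂ , z₂≈ , words₂ , cells₂ , cost₂ =
          run-run i {w = w₁} {s₁}
            (λ x l → trans (words₁ (other x) l) (proj₁ (fresh (here refl) x l)) ,
                     trans (cells₁ (run-array≢0 x) (other x) l) (proj₂ (fresh (here refl) x l)))
            (λ b j r → trans (cells₁ (leafArray≢0 b j) (λ {k} _ → leaf-untagged b j k) (toℕ r))
                             (all-filled b j r))
            at-0₁ z₁≈
    in _ , w₂ , s₂ , z₂ , seq run₁ run₂ , at-0₂ , z₂≈ ,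
       (λ ¬tag l → trans (words₂ (¬tag (here refl)) l) (words₁ (¬tag ∘ there) l)) ,
       (λ y≢0 ¬tag l → trans (cells₂ y≢0 (¬tag (here refl)) l) (cells₁ y≢0 (¬tag ∘ there) l)) ,
       ℕ.≤-trans (ℕ.+-mono-≤ cost₁ cost₂)
                 (ℕ.≤-reflexive (cong suc (ℕ.+-comm (length is * runCost) runCost)))
    where
    other : ∀ x {k} → k ∈ is → ¬ Tagged (runTag k) (addr (runTag i) x)
    other x {k} k∈ tagged = All.lookup i∉is k∈
      (runTag-injective (tag-unique (addr (runTag i) x) (addr-tagged (runTag i) x) tagged))
      where
      runTag-injective : runTag i ≡ runTag k → i ≡ k
      runTag-injective refl = refl
    run-array≢0 : ∀ x → addr (runTag i) x ≢ 0
    run-array≢0 x ()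
    leaf-untagged : ∀ b j k → ¬ Tagged (runTag k) (leafArray b j)
    leaf-untagged b j k tagged = leafTag≢runTag b k
      (tag-unique (leafArray b j) (addr-tagged (leafTag b) (toℕ j)) tagged)

  length-allLeaves : length allLeaves ≡ 2 * m
  length-allLeaves = trans (length-cartesianProduct (false ∷ true ∷ []) (allFin m))
                           (cong (2 *_) (length-tabulate {n = m} id))

  ∈-allLeaves : ∀ b j → (b , j) ∈ allLeaves
  ∈-allLeaves false j = ∈-cartesianProduct⁺ {xs = false ∷ true ∷ []} (here refl) (∈-allFin j)
  ∈-allLeaves true  j = ∈-cartesianProduct⁺ {xs = false ∷ true ∷ []} (there (here refl)) (∈-allFin j)

  addAllBlocksCost : Dec (d ≡ 0) → ℕ
  addAllBlocksCost (yes _) = 1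
  addAllBlocksCost (no  _) = 1 + (2 * m) * leafCost + (1 + m * runCost)

  run-addAllBlocks : ∀ (d≟0 : Dec (d ≡ 0)) {z s} →
    (∀ {y} → y ≢ 0 → ∀ l → s y l ≡ nothing) → s 0 0 ≡ just z → z ≈ᴿ F 0ᴹ →
    ∃ λ T → ∃ λ σ′ → ∃ λ z′ →
    Run V (addAllBlocks d≟0) ((λ _ _ → 0) , s) T σ′ × output V σ′ ≡ just z′ × z′ ≈ᴿ F J ×
    T ≤ addAllBlocksCost d≟0
  run-addAllBlocks (yes d≡0) {z} fresh at-0 z≈ =
    _ , _ , z , skip , at-0 ,
    R-trans z≈ (F-cong λ x y → contradiction (subst Fin d≡0 y) λ ()) ,
    ℕ.≤-refl
  run-addAllBlocks (no d≢0) {z} {s} fresh at-0 z≈ =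
    let T₁ , w₁ , s₁ , run₁ , filled₁ , cells₁ , words₁ , cost₁ =
          run-fills (ℕ.n≢0⇒n>0 d≢0) allLeaves (λ _ _ → 0) s
        T₂ , w₂ , s₂ , z₂ , run₂ , at-0₂ , z₂≈ , _ , _ , cost₂ =
          run-runs (allFin m) (allFin⁺ m) {w = w₁} {s₁}
            (λ {i} _ x l → words₁ (λ ()) l ,
               trans (cells₁ (λ b j → addr-otherTag x (toℕ j) (leafTag≢runTag b i ∘ sym)) l)
                     (fresh (λ ()) l))
            (λ b j → filled₁ b j (∈-allLeaves b j))
            (trans (cells₁ (λ b j → leafArray≢0 b j ∘ sym) 0) at-0) z≈
    in _ , _ , z₂ , seq run₁ run₂ , at-0₂ , R-trans z₂≈ (F-cong J-blocks) ,
       ℕ.+-mono-≤ (ℕ.≤-trans cost₁ (ℕ.≤-reflexive (cong (λ k → 1 + k * leafCost) length-allLeaves)))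
                  (ℕ.≤-trans cost₂ (ℕ.≤-reflexive (cong (λ k → 1 + k * runCost) (length-tabulate {n = m} id))))

  1≤T-FAQ : 1 ≤ T-FAQ I
  1≤T-FAQ = run-positive I countingSemiring indicators
    (proj₁ (proj₂ (evaluates I countingSemiring indicators indicators-cong)))

  -- The constant 38 is the coefficient of T_f m n d: 13 + 1 + 5 for each of the two
  -- leaf sketches of a row.
  addAllBlocksCost-bound : ∀ d≟0 → m * (T⊙ + 5) + addAllBlocksCost d≟0
                             ≤ 38 * (m * (T⊙ + T⊕) * T-FAQ I + T_f * m * maxSize * d)
  addAllBlocksCost-bound (yes _)   =
    ℕ.≤-trans (small-bound m T⊙ T⊕ (T-FAQ I) (tree-positive ρ) (>-nonZero⁻¹ T⊕) 1≤T-FAQ)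
              (ℕ.*-monoʳ-≤ 38 (ℕ.m≤m+n (m * (T⊙ + T⊕) * T-FAQ I) (T_f * m * maxSize * d)))
  addAllBlocksCost-bound (no d≢0) =
    time-bound m T⊙ T⊕ (T-FAQ I) (tree-positive ρ) (>-nonZero⁻¹ T⊕) 1≤T-FAQ
               T_f maxSize d (>-nonZero⁻¹ T_f) (ℕ.n≢0⇒n>0 d≢0)

  run-sketchProgram : ∃ λ T → ∃ λ σ → ∃ λ out →
    Run V sketchProgram (initial V) T σ × output V σ ≡ just out × out ≈ᴿ F J ×
    T ≤ 38 * (m * (T⊙ + T⊕) * T-FAQ I + T_f * m * maxSize * d)
  run-sketchProgram =
    let T₁ , s₁ , run₁ , at-0 , frame , cost₁ = run-zeros ρ id 0 (λ _ _ → 0) (λ _ _ → nothing)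
        T₂ , σ , out , run₂ , at-0₂ , out≈ , cost₂ =
          run-addAllBlocks (d ℕ.≟ 0) {s = s₁} (λ y≢0 l → frame (inj₁ y≢0)) at-0 (zeroSketch≈F Sk)
    in _ , σ , out , seq run₁ run₂ , at-0₂ , out≈ ,
       ℕ.≤-trans (ℕ.+-mono-≤ (ℕ.≤-trans (ℕ.m≤m+n T₁ (T⊙ + 3)) cost₁) cost₂)
                 (addAllBlocksCost-bound (d ℕ.≟ 0))

theorem19 : ∀ {c ℓ₁ ℓ₂ r ℓ} → ∃ λ (C : ℕ) →
    ∀ (𝕊 : Scalars c ℓ₁ ℓ₂) (Q : Query) → Acyclic Q →
    ∀ (ρ : MulTree (Query.m Q)) (A : FAQAlgorithm 𝕊 Q ρ) →
    ∃ λ (program : Cmd Q (Sketching Q)) →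
    ∀ (I : Tables 𝕊 Q) (Sk : DBSketch 𝕊 (Query.d Q) (Join.∣D∣ I) ρ r ℓ) →
    ∀ (T⊕ T⊙ T_f : ℕ) → NonZero T⊕ → NonZero T⊙ → NonZero T_f →
    let open Query Q
        n = Tables.maxSize I
        T_FAQ = FAQAlgorithm.T-FAQ A I
        open Semantics I
        V = sketchValues Sk T⊕ T⊙ T_f
        open DBSketch Sk
    in ∃ λ t → ∃ λ σ → ∃ λ out →
       Run V program (initial V) t σ ×
       output V σ ≡ just out × out ≈ F (Join.J I) ×
       t ≤ C * (m * (T⊙ + T⊕) * T_FAQ + T_f * m * n * d)
theorem19 = 38 , λ 𝕊 Q _ ρ A →
  SketchProgram.sketchProgram Q ρ (FAQAlgorithm.program A) ,
  λ I Sk T⊕ T⊙ T_f T⊕≢0 T⊙≢0 T_f≢0 →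
  Execution.run-sketchProgram A I Sk T⊕ T⊙ T_f {{T⊕≢0}} {{T⊙≢0}} {{T_f≢0}}
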